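{- Let $\Delta,\nu$ be positive integers. Consider the finite simple graphs $G$ with no isolated vertices such that $\Delta(G)=\Delta$, $\nu(G)=\nu$ and $$|E(G)|=\Delta\nu+\left\lfloor\frac{\nu}{\lceil\Delta/2\rceil}\right\rfloor\left\lfloor\frac{\Delta}{2}\right\rfloor.$$ Such a graph $G$ is unique up to isomorphism if and only if $\lceil\Delta/2\rceil$ divides $\nu$ or $\nu=1$.
   Context: All graphs are finite and simple. $\Delta(G)$ is the maximum degree of $G$, $\nu(G)$ the size of a maximum matching, $E(G)$ the edge set. -}

module Defs where

open import Data.Nat using (ℕ; zero; suc; _+_; _*_; _≤_; _/_; _<ᵇ_)
open import Data.Bool using (Bool; true; false; if_then_else_; _∧_)
open import Data.Fin using (Fin; toℕ)
import Data.Fin as F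
open import Data.Product using (Σ; ∃; _×_; _,_)
open import Relation.Binary.PropositionalEquality using (_≡_; _≢_)
open import Function.Bundles using (_↔_; Inverse)

record Graph : Set where
  field
    n      : ℕ
    adj    : Fin n → Fin n → Bool
    sym    : ∀ i j → adj i j ≡ adj j i
    irrefl : ∀ i → adj i i ≡ false
open Graph public

sumF : ∀ {m} → (Fin m → ℕ) → ℕ
sumF {zero}  f = 0
sumF {suc m} f = f F.zero + sumF (λ i → f (F.suc i))

countF : ∀ {m} → (Fin m → Bool) → ℕ
countF f = sumF (λ i → if f i then 1 else 0)

degree : (G : Graph) → Fin (n G) → ℕ
degree G i = countF (adj G i)

edgeCount : Graph → ℕ
edgeCount G = sumF (λ i → countF (λ j → (toℕ i <ᵇ toℕ j) ∧ adj G i j))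

NoIsolated : Graph → Set
NoIsolated G = ∀ i → 1 ≤ degree G i

MaxDegreeIs : Graph → ℕ → Set
MaxDegreeIs G d = (∀ i → degree G i ≤ d) × ∃ (λ i → degree G i ≡ d)

HasMatching : Graph → ℕ → Set
HasMatching G k =
  Σ (Fin k → Fin (n G)) λ f → Σ (Fin k → Fin (n G)) λ g →
    (∀ x → adj G (f x) (g x) ≡ true) ×
    (∀ x y → f x ≡ f y → x ≡ y) ×
    (∀ x y → g x ≡ g y → x ≡ y) ×
    (∀ x y → f x ≢ g y)

MatchingNumberIs : Graph → ℕ → Set
MatchingNumberIs G k = HasMatching G k × (∀ m → HasMatching G m → m ≤ k)

Isomorphic : Graph → Graph → Set
Isomorphic G H = Σ (Fin (n G) ↔ Fin (n H)) λ φ →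
  ∀ i j → adj G i j ≡ adj H (Inverse.to φ i) (Inverse.to φ j)

-- floor division (only used with a positive divisor)
fdiv : ℕ → ℕ → ℕ
fdiv a zero    = 0
fdiv a (suc d) = a / suc d

Extremal : ℕ → ℕ → Graph → Set
Extremal Δ ν G =
  NoIsolated G × MaxDegreeIs G Δ × MatchingNumberIs G ν ×
  (edgeCount G ≡ Δ * ν + fdiv ν Data.Nat.⌈ Δ /2⌉ * Data.Nat.⌊ Δ /2⌋)

{-# OPTIONS --safe #-}
module Submission where

-- Write c = ⌈Δ/2⌉ and h = ⌊Δ/2⌋. If deleting some vertex lowers ν, the number of edges drops by at most Δ.
-- Otherwise every vertex is missed by a maximum matching and, by Gallai's lemma, "no maximum matching misses
-- both" is an equivalence relation. A class C is a union of components, has 2k + 1 vertices where k of the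
-- matching edges lie inside C, and spans at most Δk + h edges, and at most Δk if k < c. Induction on ν gives
-- the bound Δν + ⌊ν/c⌋h. If c divides ν and Δ ≥ 2, equality forces k = c and Δc + h edges for every class,
-- which determines the class: a complete graph for even Δ, and for odd Δ the complement of a path on three
-- vertices plus disjoint edges. These graphs, as well as the extremal graphs for Δ = 1 and ν = 1, are described
-- by cotrees, so that any two extremal graphs realize the same cotree. If c does not divide ν, the remainder
-- modulo c leaves a choice: two stars or K_{2,Δ} when it is at least 2; when it is 1, a star next to a
-- component may share a vertex with it (Δ odd), or both may be replaced by a Δ-regular graph on Δ + 3 vertices (Δ even).

open import Defs renaming (sym to adj-sym; irrefl to adj-irrefl)
open import Data.Bool using (Bool; true; false; if_then_else_; _∧_; not)
open import Data.Bool.Properties using (∧-comm; ¬-not; ∧-zeroʳ)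
open import Data.Empty using (⊥; ⊥-elim)
open import Data.Fin using (Fin; zero; suc; toℕ; _↑ˡ_; _↑ʳ_; splitAt)
open import Data.Fin.Properties using (_≟_; any?; all?; ¬∀⟶∃¬; toℕ-injective; splitAt-↑ˡ; splitAt-↑ʳ; join-splitAt; ↑ˡ-injective; ↑ʳ-injective)
open import Data.Fin.Permutation using (↔⇒≡)
open import Data.Nat using (ℕ; zero; suc; _+_; _*_; _∸_; _/_; _≤_; _<_; z≤n; s≤s; _<ᵇ_; ⌈_/2⌉; ⌊_/2⌋; _≤?_)
open import Data.Nat.DivMod using (_%_; m≡m%n+[m/n]*n; m%n<n; /-monoˡ-≤; m/n≡1+[m∸n]/n; m*n/n≡m; m<n⇒m/n≡0; m<n*o⇒m/o<n)
open import Data.Nat.Divisibility using (_∣_; divides; _∣?_; m%n≡0⇒n∣m)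
open import Data.Nat.Properties hiding (_≟_)
open import Data.Nat.Tactic.RingSolver using (solve-∀)
open import Data.Product using (Σ; ∃; ∃₂; _×_; _,_; proj₁; proj₂)
open import Data.Sum using (_⊎_; inj₁; inj₂; [_,_]′)
open import Data.Unit using (⊤; tt)
open import Function using (_∘_; id; const)
open import Function.Bundles using (mk↔ₛ′)
open import Relation.Binary.Definitions using (tri<; tri≈; tri>)
open import Relation.Binary.PropositionalEquality using (_≡_; _≢_; refl; sym; trans; cong; cong₂; subst; module ≡-Reasoning)
open import Relation.Nullary using (¬_; Dec; yes; no; does; contradiction)
open import Relation.Nullary.Decidable using (_×-dec_; _⊎-dec_; ¬?; map′; dec-true; dec-false)

-- Finite sums and counting

-- Deleted vertices stay as isolated vertices, so all graphs of an induction live on the same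
-- `Fin n` and a matching of a part is a matching of the whole with more fixed points. The price is
-- that the absence of isolated vertices does not survive the induction; the classification
-- therefore carries the set `S` of vertices that still have edges. Uniqueness comes from the jump
-- of ⌊ν/c⌋h: if c divides ν, every outcome of the decomposition other than a class with k = c loses
-- at least h edges. This is a contradiction only for h ≥ 1, which is why Δ = 1 is treated apart. In
-- the other direction the competing graphs always have different numbers of vertices, so no finer
-- invariant is compared, and their matching numbers need only be bounded from above: the edge bound
-- supplies the rest.

ind : Bool → ℕ
ind b = if b then 1 else 0

sumF-cong : ∀ {m} {f g : Fin m → ℕ} → (∀ i → f i ≡ g i) → sumF f ≡ sumF g
sumF-cong {zero}  p = refl
sumF-cong {suc m} p = cong₂ _+_ (p zero) (sumF-cong (p ∘ suc))

sumF-mono : ∀ {m} {f g : Fin m → ℕ} → (∀ i → f i ≤ g i) → sumF f ≤ sumF g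
sumF-mono {zero}  p = z≤n
sumF-mono {suc m} p = +-mono-≤ (p zero) (sumF-mono (p ∘ suc))

interchange : ∀ a b c d → (a + b) + (c + d) ≡ (a + c) + (b + d)
interchange = solve-∀

sumF-+ : ∀ {m} (f g : Fin m → ℕ) → sumF (λ i → f i + g i) ≡ sumF f + sumF g
sumF-+ {zero}  f g = refl
sumF-+ {suc m} f g = trans (cong (f zero + g zero +_) (sumF-+ (f ∘ suc) (g ∘ suc)))
                           (interchange (f zero) (g zero) _ _)

sumF-const : ∀ m k → sumF {m} (λ _ → k) ≡ m * k
sumF-const zero    k = refl
sumF-const (suc m) k = cong (k +_) (sumF-const m k)

sumF-0 : ∀ m → sumF {m} (λ _ → 0) ≡ 0
sumF-0 m = trans (sumF-const m 0) (*-zeroʳ m)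

sumF-*ʳ : ∀ {m} (f : Fin m → ℕ) k → sumF (λ i → f i * k) ≡ sumF f * k
sumF-*ʳ {zero}  f k = refl
sumF-*ʳ {suc m} f k = trans (cong (f zero * k +_) (sumF-*ʳ (f ∘ suc) k))
                            (sym (*-distribʳ-+ k (f zero) _))

sumF-swap : ∀ {m k} (f : Fin m → Fin k → ℕ) →
  sumF (λ i → sumF (λ j → f i j)) ≡ sumF (λ j → sumF (λ i → f i j))
sumF-swap {zero}  {k} f = sym (sumF-0 k)
sumF-swap {suc m} f = trans (cong (sumF (f zero) +_) (sumF-swap (f ∘ suc)))
                            (sym (sumF-+ (f zero) (λ j → sumF (λ i → f (suc i) j))))

sumF-↑ : ∀ a b (f : Fin (a + b) → ℕ) →
  sumF f ≡ sumF (λ i → f (i ↑ˡ b)) + sumF (λ j → f (a ↑ʳ j))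
sumF-↑ zero    b f = refl
sumF-↑ (suc a) b f = trans (cong (f zero +_) (sumF-↑ a b (f ∘ suc)))
                           (sym (+-assoc (f zero) _ _))

term≤sumF : ∀ {m} (f : Fin m → ℕ) i → f i ≤ sumF f
term≤sumF f zero    = m≤m+n _ _
term≤sumF f (suc i) = ≤-trans (term≤sumF (f ∘ suc) i) (m≤n+m _ _)

sumF≡0 : ∀ {m} (f : Fin m → ℕ) → sumF f ≡ 0 → ∀ i → f i ≡ 0
sumF≡0 f p i = n≤0⇒n≡0 (subst (f i ≤_) p (term≤sumF f i))

sumF-tight : ∀ {m} {f g : Fin m → ℕ} → (∀ i → f i ≤ g i) → sumF f ≡ sumF g → ∀ i → f i ≡ g i
sumF-tight {suc m} {f} {g} p e = go
  where
  head≡ : f zero ≡ g zero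
  head≡ = ≤-antisym (p zero) (+-cancelʳ-≤ (sumF (f ∘ suc)) (g zero) (f zero)
    (≤-trans (+-monoʳ-≤ (g zero) (sumF-mono (p ∘ suc))) (≤-reflexive (sym e))))
  go : ∀ i → f i ≡ g i
  go zero    = head≡
  go (suc i) = sumF-tight (p ∘ suc)
    (+-cancelˡ-≡ (g zero) _ _ (trans (cong (_+ sumF (f ∘ suc)) (sym head≡)) e)) i

-- A total surplus of one has to sit in a single term. For odd Δ this finds the one vertex of degree
-- 2 in the complement of an extremal class.
sumF-tight₁ : ∀ {m} {f g : Fin m → ℕ} → (∀ i → f i ≤ g i) → sumF g ≡ suc (sumF f) →
  ∃ λ a → g a ≡ suc (f a) × (∀ i → i ≢ a → f i ≡ g i)
sumF-tight₁ {suc m} {f} {g} p e with m≤n⇒m<n∨m≡n (p zero)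
... | inj₂ h with sumF-tight₁ {m} {f ∘ suc} {g ∘ suc} (p ∘ suc)
                 (+-cancelˡ-≡ (g zero) _ _ (trans e (trans (cong (λ z → suc (z + _)) h) (sym (+-suc (g zero) _)))))
...   | a , ga , q = suc a , ga , λ { zero _ → h ; (suc i) i≢ → q i (i≢ ∘ cong suc) }
sumF-tight₁ {suc m} {f} {g} p e | inj₁ h = zero , head≡ , λ { zero 0≢0 → contradiction refl 0≢0 ; (suc i) _ → tail≡ i }
  where
  head≡ : g zero ≡ suc (f zero)
  head≡ = ≤-antisym (+-cancelʳ-≤ (sumF (f ∘ suc)) _ _
    (≤-trans (+-monoʳ-≤ (g zero) (sumF-mono (p ∘ suc))) (≤-reflexive e))) h
  tail≡ : ∀ i → f (suc i) ≡ g (suc i)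
  tail≡ = sumF-tight (p ∘ suc) (sym (+-cancelˡ-≡ (g zero) _ _ (trans e (cong (_+ sumF (f ∘ suc)) (sym head≡)))))

infix 6 _≈ᵇ_
_≈ᵇ_ : ∀ {m} → Fin m → Fin m → Bool
i ≈ᵇ j = does (i ≟ j)

≈ᵇ-refl : ∀ {m} (i : Fin m) → i ≈ᵇ i ≡ true
≈ᵇ-refl i = dec-true (i ≟ i) refl

≈ᵇ-≢ : ∀ {m} {i j : Fin m} → i ≢ j → i ≈ᵇ j ≡ false
≈ᵇ-≢ {i = i} {j} = dec-false (i ≟ j)

≈ᵇ-sym : ∀ {m} (i j : Fin m) → i ≈ᵇ j ≡ j ≈ᵇ i
≈ᵇ-sym i j with i ≟ j
... | yes refl = sym (≈ᵇ-refl i)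
... | no i≢j   = sym (≈ᵇ-≢ (i≢j ∘ sym))

sumF-pick : ∀ {m} (i : Fin m) (f : Fin m → ℕ) → sumF (λ j → if i ≈ᵇ j then f j else 0) ≡ f i
sumF-pick {suc m} zero    f = trans (cong (f zero +_) (sumF-0 m)) (+-identityʳ _)
sumF-pick {suc m} (suc i) f = sumF-pick i (f ∘ suc)

countF-≈ᵇ : ∀ {m} (i : Fin m) → countF (i ≈ᵇ_) ≡ 1
countF-≈ᵇ i = sumF-pick i (λ _ → 1)

true≢false : ∀ {b} → b ≡ true → b ≡ false → ⊥
true≢false refl ()

not-true : ∀ {b} → not b ≡ true → b ≡ false
not-true {false} _ = refl

∧-true⁻ : ∀ {a b} → a ∧ b ≡ true → a ≡ true × b ≡ true
∧-true⁻ {true} {true} _ = refl , refl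

countF-mono : ∀ {m} (f g : Fin m → Bool) → (∀ i → f i ≡ true → g i ≡ true) → countF f ≤ countF g
countF-mono f g p = sumF-mono λ i → step i (f i) refl
  where
  step : ∀ i b → f i ≡ b → ind b ≤ ind (g i)
  step i false _ = z≤n
  step i true  e rewrite p i e = ≤-refl

countF-cong : ∀ {m} {f g : Fin m → Bool} → (∀ i → f i ≡ g i) → countF f ≡ countF g
countF-cong p = sumF-cong (cong ind ∘ p)

countF-true : ∀ m → countF {m} (const true) ≡ m
countF-true m = trans (sumF-const m 1) (*-identityʳ m)

countF-≤ : ∀ {m} (f : Fin m → Bool) → countF f ≤ m
countF-≤ {m} f = ≤-trans (countF-mono f (const true) (λ _ _ → refl)) (≤-reflexive (countF-true m))

countF-pos : ∀ {m} (f : Fin m → Bool) {i} → f i ≡ true → 1 ≤ countF f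
countF-pos f {i} e = ≤-trans (≤-reflexive (sym (cong ind e))) (term≤sumF (ind ∘ f) i)

countF-witness : ∀ {m} (f : Fin m → Bool) → 1 ≤ countF f → ∃ λ i → f i ≡ true
countF-witness {suc m} f p with f zero in e
... | true  = zero , e
... | false with countF-witness (f ∘ suc) p
...   | i , q = suc i , q

countF≡0 : ∀ {m} (f : Fin m → Bool) → countF f ≡ 0 → ∀ i → f i ≡ false
countF≡0 f p i = ¬-not λ e → 1+n≰n (≤-trans (countF-pos f e) (≤-reflexive p))

infixl 5 _∖_
_∖_ : ∀ {m} → (Fin m → Bool) → Fin m → Fin m → Bool
(f ∖ i) j = not (i ≈ᵇ j) ∧ f j

∖⁻ : ∀ {m} (f : Fin m → Bool) i {j} → (f ∖ i) j ≡ true → j ≢ i × f j ≡ true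
∖⁻ f i {j} p with i ≟ j
... | no i≢j = i≢j ∘ sym , p

∖⁺ : ∀ {m} (f : Fin m → Bool) i {j} → j ≢ i → f j ≡ true → (f ∖ i) j ≡ true
∖⁺ f i {j} j≢i p rewrite ≈ᵇ-≢ (j≢i ∘ sym) = p

countF-∖ : ∀ {m} (f : Fin m → Bool) {i} → f i ≡ true → countF f ≡ suc (countF (f ∖ i))
countF-∖ f {i} p = trans (sumF-cong step)
  (trans (sumF-+ _ (ind ∘ (f ∖ i))) (cong (_+ countF (f ∖ i)) (countF-≈ᵇ i)))
  where
  step : ∀ j → ind (f j) ≡ ind (i ≈ᵇ j) + ind ((f ∖ i) j)
  step j with i ≟ j
  ... | yes refl = cong ind p
  ... | no _     = refl

countF-suc : ∀ {m k} (f : Fin m → Bool) → countF f ≡ suc k →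
  ∃ λ i → f i ≡ true × countF (f ∖ i) ≡ k
countF-suc f p with countF-witness f (≤-trans (s≤s z≤n) (≤-reflexive (sym p)))
... | i , q = i , q , suc-injective (trans (sym (countF-∖ f q)) p)

countF≡1 : ∀ {m} (f : Fin m → Bool) → countF f ≡ 1 →
  ∃ λ i → f i ≡ true × (∀ {j} → f j ≡ true → j ≡ i)
countF≡1 f p with countF-suc f p
... | i , fi , q = i , fi , unique
  where
  unique : ∀ {j} → f j ≡ true → j ≡ i
  unique {j} fj with j ≟ i
  ... | yes j≡i = j≡i
  ... | no j≢i  = ⊥-elim (true≢false (∖⁺ f i j≢i fj) (countF≡0 _ q j))

countF-none : ∀ {m} (f : Fin m → Bool) → (∀ i → f i ≡ false) → countF f ≡ 0
countF-none {m} f p = trans (countF-cong {f = f} {const false} p) (sumF-0 m)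

-- Matchings as involutions

degreeSum : Graph → ℕ
degreeSum G = sumF (degree G)

handshake : ∀ G → degreeSum G ≡ edgeCount G + edgeCount G
handshake G = begin
  degreeSum G
    ≡⟨ sumF-cong (λ i → trans (sumF-cong (split i)) (sumF-+ (up i) (λ j → up j i))) ⟩
  sumF (λ i → sumF (up i) + sumF (λ j → up j i))
    ≡⟨ sumF-+ (λ i → sumF (up i)) (λ i → sumF (λ j → up j i)) ⟩
  edgeCount G + sumF (λ i → sumF (λ j → up j i))
    ≡⟨ cong (edgeCount G +_) (sumF-swap (λ i j → up j i)) ⟩
  edgeCount G + edgeCount G ∎
  where
  open ≡-Reasoning
  up : Fin (n G) → Fin (n G) → ℕ
  up i j = ind ((toℕ i <ᵇ toℕ j) ∧ adj G i j)
  <ᵇ-true : ∀ {a b} → (a <ᵇ b) ≡ true → a < b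
  <ᵇ-true {a} {b} p = <ᵇ⇒< a b (subst Data.Bool.T (sym p) tt)
  <ᵇ-false : ∀ {a b} → (a <ᵇ b) ≡ false → b ≤ a
  <ᵇ-false {a} {b} p = ≮⇒≥ λ a<b → subst Data.Bool.T p (<⇒<ᵇ a<b)
  split : ∀ i j → ind (adj G i j) ≡ up i j + up j i
  split i j with toℕ i <ᵇ toℕ j in p | toℕ j <ᵇ toℕ i in q
  ... | true  | true  = contradiction (<ᵇ-true {toℕ i} p) (<-asym (<ᵇ-true {toℕ j} q))
  ... | true  | false = sym (+-identityʳ _)
  ... | false | true  = cong ind (adj-sym G i j)
  ... | false | false with toℕ-injective (≤-antisym (<ᵇ-false {toℕ j} q) (<ᵇ-false {toℕ i} p))
  ...   | refl = cong ind (adj-irrefl G i)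

adj⇒≢ : ∀ G {i j} → adj G i j ≡ true → i ≢ j
adj⇒≢ G {i} p refl = true≢false p (adj-irrefl G i)

-- The missed vertices are the fixed points. In this form the matchings can be searched
-- exhaustively, restricted and pasted pointwise.
IsMatching : (G : Graph) → (Fin (n G) → Fin (n G)) → Set
IsMatching G m = (∀ v → m (m v) ≡ v) × (∀ v → m v ≡ v ⊎ adj G v (m v) ≡ true)

moved : ∀ {k} → (Fin k → Fin k) → Fin k → Bool
moved m v = not (m v ≈ᵇ v)

-- Counts covered vertices, i.e. twice the number of edges of the matching.
cov : ∀ {k} → (Fin k → Fin k) → ℕ
cov m = countF (moved m)

moved-fix : ∀ {k} {m : Fin k → Fin k} {v} → m v ≡ v → moved m v ≡ false
moved-fix {m = m} {v} p = cong not (dec-true (m v ≟ v) p)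

moved-≢ : ∀ {k} {m : Fin k → Fin k} {v} → m v ≢ v → moved m v ≡ true
moved-≢ p = cong not (≈ᵇ-≢ p)

moved⁻ : ∀ {k} {m : Fin k → Fin k} {v} → moved m v ≡ true → m v ≢ v
moved⁻ {m = m} {v} p q = true≢false p (moved-fix {m = m} q)

moved-cong : ∀ {k l} {m : Fin k → Fin k} {m' : Fin l → Fin l} {v w} →
  (m v ≡ v → m' w ≡ w) → (m' w ≡ w → m v ≡ v) → moved m v ≡ moved m' w
moved-cong {m = m} {m'} {v} {w} to from with m v ≟ v
... | yes p = sym (moved-fix {m = m'} (to p))
... | no p  = sym (moved-≢ {m = m'} (p ∘ from))

cov-id : ∀ k → cov {k} id ≡ 0
cov-id k = countF-none {k} (moved id) (λ v → moved-fix {m = id} {v} refl)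

id-isMatching : ∀ G → IsMatching G id
id-isMatching G = (λ _ → refl) , (λ _ → inj₁ refl)

module _ {k : ℕ} where

  update : (Fin k → Fin k) → Fin k → Fin k → Fin k → Fin k
  update m u a v = if u ≈ᵇ v then a else m v

  update-≡ : ∀ m u a → update m u a u ≡ a
  update-≡ m u a rewrite ≈ᵇ-refl u = refl

  update-≢ : ∀ m u a {v} → v ≢ u → update m u a v ≡ m v
  update-≢ m u a v≢u rewrite ≈ᵇ-≢ (v≢u ∘ sym) = refl

  opaque
    unmatch : (Fin k → Fin k) → Fin k → Fin k → Fin k
    unmatch m u = update (update m u u) (m u) (m u)

    unmatch-fst : ∀ m u → unmatch m u u ≡ u
    unmatch-fst m u with m u ≟ u
    ... | yes p = p
    ... | no _  = update-≡ m u u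

    unmatch-snd : ∀ m u → unmatch m u (m u) ≡ m u
    unmatch-snd m u = update-≡ (update m u u) (m u) (m u)

    unmatch-other : ∀ m u {v} → v ≢ u → v ≢ m u → unmatch m u v ≡ m v
    unmatch-other m u v≢u v≢mu = trans (update-≢ (update m u u) (m u) _ v≢mu) (update-≢ m u _ v≢u)

    rematch : (Fin k → Fin k) → Fin k → Fin k → Fin k → Fin k
    rematch m u w = update (update m u w) w u

    rematch-fst : ∀ m {u w} → u ≢ w → rematch m u w u ≡ w
    rematch-fst m {u} {w} u≢w = trans (update-≢ (update m u w) w u u≢w) (update-≡ m u w)

    rematch-snd : ∀ m {u w} → rematch m u w w ≡ u
    rematch-snd m {u} {w} = update-≡ (update m u w) w u

    rematch-other : ∀ m {u w v} → v ≢ u → v ≢ w → rematch m u w v ≡ m v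
    rematch-other m {u} {w} v≢u v≢w = trans (update-≢ (update m u w) w u v≢w) (update-≢ m u w v≢u)

  data OneOf (u w v : Fin k) : Set where
    fst   : v ≡ u → OneOf u w v
    snd   : v ≡ w → OneOf u w v
    other : v ≢ u → v ≢ w → OneOf u w v

  oneOf : ∀ u w v → OneOf u w v
  oneOf u w v with v ≟ u | v ≟ w
  ... | yes p | _     = fst p
  ... | no _  | yes q = snd q
  ... | no p  | no q  = other p q

  cov-two : ∀ (m m' : Fin k → Fin k) {u w} → u ≢ w → m u ≢ u → m w ≢ w → m' u ≡ u → m' w ≡ w →
    (∀ {v} → v ≢ u → v ≢ w → m' v ≡ m v) → cov m ≡ 2 + cov m'
  cov-two m m' {u} {w} u≢w mu mw m'u m'w same = begin
    cov m
      ≡⟨ sumF-cong step ⟩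
    sumF (λ v → ind (u ≈ᵇ v) + (ind (w ≈ᵇ v) + ind (moved m' v)))
      ≡⟨ sumF-+ (ind ∘ (u ≈ᵇ_)) _ ⟩
    countF (u ≈ᵇ_) + sumF (λ v → ind (w ≈ᵇ v) + ind (moved m' v))
      ≡⟨ cong₂ _+_ (countF-≈ᵇ u) (trans (sumF-+ (ind ∘ (w ≈ᵇ_)) _) (cong (_+ cov m') (countF-≈ᵇ w))) ⟩
    2 + cov m' ∎
    where
    open ≡-Reasoning
    step : ∀ v → ind (moved m v) ≡ ind (u ≈ᵇ v) + (ind (w ≈ᵇ v) + ind (moved m' v))
    step v with oneOf u w v
    ... | fst refl rewrite moved-≢ {m = m} mu | ≈ᵇ-refl u | ≈ᵇ-≢ (u≢w ∘ sym) | moved-fix {m = m'} m'u = refl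
    ... | snd refl rewrite moved-≢ {m = m} mw | ≈ᵇ-refl w | ≈ᵇ-≢ u≢w | moved-fix {m = m'} m'w = refl
    ... | other p q rewrite ≈ᵇ-≢ (p ∘ sym) | ≈ᵇ-≢ (q ∘ sym) | same p q = refl

module _ (G : Graph) where

  private V = Fin (n G)

  matched-adj : ∀ {m} → IsMatching G m → ∀ {v} → m v ≢ v → adj G v (m v) ≡ true
  matched-adj (_ , e) {v} p with e v
  ... | inj₁ q = contradiction q p
  ... | inj₂ q = q

  involution-≢ : ∀ (m : V → V) → (∀ v → m (m v) ≡ v) → ∀ {u v} → v ≢ m u → m v ≢ u
  involution-≢ m inv p refl = p (sym (inv _))

  unmatch-isMatching : ∀ {m} → IsMatching G m → ∀ u → IsMatching G (unmatch m u)
  unmatch-isMatching {m} (inv , e) u = inv' , e'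
    where
    m' = unmatch m u
    inv' : ∀ v → m' (m' v) ≡ v
    inv' v with oneOf u (m u) v
    ... | fst refl = trans (cong m' (unmatch-fst m v)) (unmatch-fst m v)
    ... | snd refl = trans (cong m' (unmatch-snd m u)) (unmatch-snd m u)
    ... | other p q = trans (cong m' (unmatch-other m u p q))
      (trans (unmatch-other m u (involution-≢ m inv q) (involution-≢ m inv (λ r → p (trans r (inv u))))) (inv v))
    e' : ∀ v → m' v ≡ v ⊎ adj G v (m' v) ≡ true
    e' v with oneOf u (m u) v
    ... | fst refl = inj₁ (unmatch-fst m v)
    ... | snd refl = inj₁ (unmatch-snd m u)
    ... | other p q rewrite unmatch-other m u p q = e v

  cov-unmatch : ∀ {m} → IsMatching G m → ∀ {u} → m u ≢ u → cov m ≡ 2 + cov (unmatch m u)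
  cov-unmatch {m} (inv , _) {u} p = cov-two m (unmatch m u) (p ∘ sym) p (λ q → p (trans (sym q) (inv u)))
    (unmatch-fst m u) (unmatch-snd m u) (unmatch-other m u)

  rematch-isMatching : ∀ {m} → IsMatching G m → ∀ {u w} → m u ≡ u → m w ≡ w → adj G u w ≡ true →
    IsMatching G (rematch m u w)
  rematch-isMatching {m} (inv , e) {u} {w} mu mw uw = inv' , e'
    where
    m' = rematch m u w
    u≢w = adj⇒≢ G uw
    inv' : ∀ v → m' (m' v) ≡ v
    inv' v with oneOf u w v
    ... | fst refl = trans (cong m' (rematch-fst m u≢w)) (rematch-snd m)
    ... | snd refl = trans (cong m' (rematch-snd m)) (rematch-fst m u≢w)
    ... | other p q = trans (cong m' (rematch-other m p q))
      (trans (rematch-other m (involution-≢ m inv (λ r → p (trans r mu))) (involution-≢ m inv (λ r → q (trans r mw)))) (inv v))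
    e' : ∀ v → m' v ≡ v ⊎ adj G v (m' v) ≡ true
    e' v with oneOf u w v
    ... | fst refl rewrite rematch-fst m u≢w = inj₂ uw
    ... | snd refl rewrite rematch-snd m {u} {v} = inj₂ (trans (adj-sym G v u) uw)
    ... | other p q rewrite rematch-other m p q = e v

  cov-rematch : ∀ (m : V → V) {u w} → m u ≡ u → m w ≡ w → u ≢ w → cov (rematch m u w) ≡ 2 + cov m
  cov-rematch m mu mw u≢w = cov-two (rematch m _ _) m u≢w
    (λ p → u≢w (trans (sym p) (rematch-fst m u≢w))) (λ p → u≢w (trans (sym (rematch-snd m)) p))
    mu mw (λ p q → sym (rematch-other m p q))

  -- Edges are peeled off one at a time. Besides the translation, this is where `cov m` is seen to
  -- be even, on which the later parity arguments rest.
  matching⇒HasMatching : ∀ {m} → IsMatching G m → ∃ λ k → cov m ≡ k + k × HasMatching G k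
  matching⇒HasMatching M with go _ M ≤-refl
    where
    -- Recording that `m` moves every listed end keeps the edges found after `unmatch` away from `u`
    -- and `m u`, which are then fixed.
    Edges : (V → V) → ℕ → Set
    Edges m k = Σ (HasMatching G k) λ (f , g , _) → (∀ x → m (f x) ≢ f x) × (∀ x → m (g x) ≢ g x)
    go : ∀ K {m} → IsMatching G m → cov m ≤ K → ∃ λ k → cov m ≡ k + k × Edges m k
    go K {m} M c≤K with any? (λ v → ¬? (m v ≟ v))
    ... | no none = 0 , countF-none (moved m) stable ,
      ((λ ()) , (λ ()) , (λ ()) , (λ ()) , (λ ()) , (λ ())) , (λ ()) , (λ ())
      where
      stable : ∀ v → moved m v ≡ false
      stable v with m v ≟ v
      ... | yes _ = refl
      ... | no p  = contradiction (v , p) none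
    ... | yes (u , mu) with K | ≤-trans (≤-reflexive (sym (cov-unmatch M mu))) c≤K
    ...   | suc (suc K') | s≤s (s≤s c') with go K' (unmatch-isMatching M u) c'
    ...     | k , ck , (f , g , a , fi , gi , fg) , fm , gm =
      suc k , trans (cov-unmatch M mu) (trans (cong (2 +_) ck) (cong suc (sym (+-suc k k)))) ,
      (f' , g' , a' , f'i , g'i , f'g') , f'm , g'm
      where
      m' = unmatch m u
      keep : ∀ {v} → m' v ≢ v → m v ≢ v
      keep {v} p with oneOf u (m u) v
      ... | fst refl = mu
      ... | snd refl = contradiction (unmatch-snd m u) p
      ... | other q r = λ s → p (trans (unmatch-other m u q r) s)
      ≢u : ∀ {v} → m' v ≢ v → v ≢ u
      ≢u p refl = p (unmatch-fst m u)
      ≢mu : ∀ {v} → m' v ≢ v → v ≢ m u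
      ≢mu p refl = p (unmatch-snd m u)
      f' g' : Fin (suc k) → V
      f' zero = u
      f' (suc x) = f x
      g' zero = m u
      g' (suc x) = g x
      a' : ∀ x → adj G (f' x) (g' x) ≡ true
      a' zero = matched-adj M mu
      a' (suc x) = a x
      f'i : ∀ x y → f' x ≡ f' y → x ≡ y
      f'i zero zero _ = refl
      f'i zero (suc y) p = contradiction (sym p) (≢u (fm y))
      f'i (suc x) zero p = contradiction p (≢u (fm x))
      f'i (suc x) (suc y) p = cong suc (fi x y p)
      g'i : ∀ x y → g' x ≡ g' y → x ≡ y
      g'i zero zero _ = refl
      g'i zero (suc y) p = contradiction (sym p) (≢mu (gm y))
      g'i (suc x) zero p = contradiction p (≢mu (gm x))
      g'i (suc x) (suc y) p = cong suc (gi x y p)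
      f'g' : ∀ x y → f' x ≢ g' y
      f'g' zero zero p = mu (sym p)
      f'g' zero (suc y) p = ≢u (gm y) (sym p)
      f'g' (suc x) zero p = ≢mu (fm x) p
      f'g' (suc x) (suc y) = fg x y
      f'm : ∀ x → m (f' x) ≢ f' x
      f'm zero = mu
      f'm (suc x) = keep (fm x)
      g'm : ∀ x → m (g' x) ≢ g' x
      g'm zero p = mu (trans (sym p) (proj₁ M u))
      g'm (suc x) = keep (gm x)
  ... | k , c , H , _ = k , c , H

  HasMatching⇒matching : ∀ k → HasMatching G k → ∃ λ m → IsMatching G m × cov m ≡ k + k
  HasMatching⇒matching k (f , g , a , fi , gi , fg) with go k f g a fi gi fg
    where
    -- The last component, that unlisted vertices stay fixed, is what allows the next edge to be
    -- added.
    go : ∀ k (f g : Fin k → V) → (∀ x → adj G (f x) (g x) ≡ true) →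
      (∀ x y → f x ≡ f y → x ≡ y) → (∀ x y → g x ≡ g y → x ≡ y) → (∀ x y → f x ≢ g y) →
      ∃ λ m → IsMatching G m × cov m ≡ k + k × (∀ v → (∀ x → v ≢ f x) → (∀ x → v ≢ g x) → m v ≡ v)
    go zero f g a fi gi fg = id , id-isMatching G , cov-id (n G) , λ _ _ _ → refl
    go (suc k) f g a fi gi fg
      with go k (f ∘ suc) (g ∘ suc) (a ∘ suc) (λ x y p → Data.Fin.Properties.suc-injective (fi _ _ p)) (λ x y p → Data.Fin.Properties.suc-injective (gi _ _ p)) (λ x y → fg _ _)
    ... | m , M , c , free = rematch m u w , rematch-isMatching M mu mw (a zero) ,
      trans (cov-rematch m mu mw (fg zero zero)) (trans (cong (2 +_) c) (cong suc (sym (+-suc k k)))) ,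
      λ v p q → trans (rematch-other m (p zero) (q zero)) (free v (p ∘ suc) (q ∘ suc))
      where
      u = f zero
      w = g zero
      0≢suc : ∀ {x : Fin k} → Fin.zero ≢ suc x
      0≢suc ()
      mu = free u (λ x p → 0≢suc (fi _ _ p)) (λ x → fg zero (suc x))
      mw = free w (λ x p → fg (suc x) zero (sym p)) (λ x p → 0≢suc (gi _ _ p))
  ... | m , M , c , _ = m , M , c

-- The Gallai decomposition

-- Only the upper half of the matching number, since this half passes to the pieces of the
-- decomposition. `cov` counts vertices, hence `k + k`.
Bounded : Graph → ℕ → Set
Bounded G k = ∀ m → IsMatching G m → cov m ≤ k + k

-- Makes statements about the existence of a matching decidable. `resp` takes the place of function
-- extensionality: the enumerated map agrees with a given one only pointwise.
search : ∀ {k l} (P : (Fin k → Fin l) → Set) → (∀ {f g} → (∀ i → f i ≡ g i) → P f → P g) →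
  (∀ f → Dec (P f)) → Dec (∃ P)
search {zero} P resp P? with P? (λ ())
... | yes p = yes ((λ ()) , p)
... | no ¬p = no λ (f , p) → ¬p (resp (λ ()) p)
search {suc k} {l} P resp P? = map′ (λ (a , f , p) → cons a f , p)
  (λ (f , p) → f zero , f ∘ suc , resp (λ { zero → refl ; (suc i) → refl }) p)
  (any? λ a → search (P ∘ cons a) (λ q → resp (λ { zero → refl ; (suc i) → q i })) (P? ∘ cons a))
  where
  cons : Fin l → (Fin k → Fin l) → Fin (suc k) → Fin l
  cons a f zero    = a
  cons a f (suc i) = f i

double-cancel-≤ : ∀ {a b} → a + a ≤ b + b → a ≤ b
double-cancel-≤ {a} {b} p with a ≤? b
... | yes q = q
... | no q  = contradiction p (<⇒≱ (+-mono-< (≰⇒> q) (≰⇒> q)))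

-- Evenness of `cov` rules out the value 2ν + 1.
cov-parity : ∀ G {ν m} → IsMatching G m → ¬ (suc ν + suc ν ≤ cov m) → cov m ≤ ν + ν
cov-parity G {ν} M small with matching⇒HasMatching G M
... | k , c , _ rewrite c with k ≤? ν
...   | yes p = +-mono-≤ p p
...   | no p  = contradiction (+-mono-≤ (≰⇒> p) (≰⇒> p)) small

-- The vertex type is kept and the vertices outside `C` become isolated, so matchings of `G` and of
-- its parts are maps on the same set.
restrict : (G : Graph) → (Fin (n G) → Bool) → Graph
restrict G C = record
  { n      = n G
  ; adj    = λ i j → (C i ∧ C j) ∧ adj G i j
  ; sym    = λ i j → cong₂ _∧_ (∧-comm (C i) (C j)) (adj-sym G i j)
  ; irrefl = λ i → trans (cong ((C i ∧ C i) ∧_) (adj-irrefl G i)) (∧-zeroʳ (C i ∧ C i))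
  }

restrict⁻ : ∀ G C {i j} → adj (restrict G C) i j ≡ true → C i ≡ true × C j ≡ true × adj G i j ≡ true
restrict⁻ G C p with ∧-true⁻ p
... | q , r with ∧-true⁻ q
...   | ci , cj = ci , cj , r

restrict⁺ : ∀ G C {i j} → C i ≡ true → C j ≡ true → adj G i j ≡ true → adj (restrict G C) i j ≡ true
restrict⁺ G C ci cj p rewrite ci | cj = p

delete : (G : Graph) → Fin (n G) → Graph
delete G v = restrict G (λ i → not (v ≈ᵇ i))

restrict-matching : ∀ G C {m} → IsMatching (restrict G C) m → IsMatching G m
restrict-matching G C {m} (inv , e) = inv , e'
  where
  e' : ∀ v → m v ≡ v ⊎ adj G v (m v) ≡ true
  e' v with e v
  ... | inj₁ p = inj₁ p
  ... | inj₂ p = inj₂ (proj₂ (proj₂ (restrict⁻ G C {v} p)))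

restrict-fixed : ∀ G C {m} → IsMatching (restrict G C) m → ∀ {v} → C v ≡ false → m v ≡ v
restrict-fixed G C {m} (_ , e) {v} cv with e v
... | inj₁ p = p
... | inj₂ p = ⊥-elim (true≢false (proj₁ (restrict⁻ G C {v} p)) cv)

-- Meant for graphs bounded by `suc ν`: the bound falls by one in `slack` and `essential`, and by
-- `k ≥ 1` outside a `component`.
data Decomposition (G : Graph) (ν : ℕ) : Set where
  slack     : Bounded G ν → Decomposition G ν
  essential : ∀ v → Bounded (delete G v) ν → Decomposition G ν
  component : ∀ C k → 1 ≤ k → k ≤ suc ν → countF C ≡ suc (k + k) →
    (∀ {i j} → C i ≡ true → adj G i j ≡ true → C j ≡ true) →
    (∀ {i} → C i ≡ true → ∃ λ j → adj G i j ≡ true) →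
    Bounded (restrict G (not ∘ C)) (suc ν ∸ k) → Decomposition G ν

module _ (G : Graph) (ν : ℕ) where

  private V = Fin (n G)

  Large : (V → V) → Set
  Large m = IsMatching G m × ν + ν ≤ cov m

  Large-resp : ∀ {f g : V → V} → (∀ i → f i ≡ g i) → Large f → Large g
  Large-resp {f} {g} eq ((inv , e) , c) =
    ((λ v → trans (sym (trans (cong f (eq v)) (eq (g v)))) (inv v)) ,
     (λ v → subst (λ w → w ≡ v ⊎ adj G v w ≡ true) (eq v) (e v))) ,
    ≤-trans c (≤-reflexive (countF-cong {f = moved f} {moved g} (λ v → cong (λ w → not (w ≈ᵇ v)) (eq v))))

  Large? : ∀ m → Dec (Large m)
  Large? m = (all? (λ v → m (m v) ≟ v) ×-dec all? (λ v → (m v ≟ v) ⊎-dec (adj G v (m v) Data.Bool.≟ true)))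
    ×-dec (ν + ν ≤? cov m)

  -- Under `Bounded G ν` the `Large` matchings are the maximum ones. A single vertex is missed when
  -- `Missing v v` holds.
  Missing : V → V → Set
  Missing u w = ∃ λ m → Large m × m u ≡ u × m w ≡ w

  missing? : ∀ u w → Dec (Missing u w)
  missing? u w = search _ (λ eq (L , p , q) → Large-resp eq L , trans (sym (eq u)) p , trans (sym (eq w)) q)
    (λ m → Large? m ×-dec (m u ≟ u) ×-dec (m w ≟ w))

  -- Among the largest matchings N missing t take one with maximal agreement with M; the exchange of
  -- the edge y (N y) for the edge x y, where x is covered by M but not by N, raises the agreement.
  gallai : Bounded G ν → ∀ {u t v} → u ≢ v → ¬ Missing u t → ¬ Missing t v → Missing t t → ¬ Missing u v
  gallai bd {u} {t} {v} u≢v ¬ut ¬tv (N₀ , L₀ , Nt₀ , _) (M , LM@((Minv , _) , cM) , Mu , Mv) =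
    go (n G) N₀ L₀ Nt₀ (m≤n+m (n G) _)
    where
    agreement : (V → V) → ℕ
    agreement N = countF (λ w → M w ≈ᵇ N w)
    ind≤1 : ∀ b → ind b ≤ 1
    ind≤1 true  = ≤-refl
    ind≤1 false = z≤n
    -- `K` bounds the number of vertices where `N` still disagrees with `M`; each exchange lowers
    -- it.
    go : ∀ K N → Large N → N t ≡ t → n G ≤ agreement N + K → ⊥
    go K N LN@(MN@(Ninv , _) , cN) Nt fuel with any? (λ x → ¬? (M x ≟ x) ×-dec (N x ≟ x) ×-dec ¬? (x ≟ t))
    ... | no none = 1+n≰n (≤-trans (+-cancelˡ-≤ (cov M) 2 1 (≤-trans cov≤ (+-monoˡ-≤ 1 (≤-trans (bd N MN) cM)))) ≤-refl)
      where
      -- Now `N` covers all that `M` covers, except possibly `t`, and also `u` and `v`, which `M`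
      -- misses. So `N` covers at least one vertex more than `M`, although both are maximum.
      point : ∀ w → ind (moved M w) + (ind (u ≈ᵇ w) + ind (v ≈ᵇ w)) ≤ ind (moved N w) + ind (t ≈ᵇ w)
      point w with oneOf u v w
      ... | fst refl rewrite moved-fix {m = M} Mu | ≈ᵇ-refl u | ≈ᵇ-≢ (u≢v ∘ sym)
                           | moved-≢ {m = N} (λ Nu → ¬ut (N , LN , Nu , Nt)) = s≤s z≤n
      ... | snd refl rewrite moved-fix {m = M} Mv | ≈ᵇ-refl v | ≈ᵇ-≢ u≢v
                           | moved-≢ {m = N} (λ Nv → ¬tv (N , LN , Nt , Nv)) = s≤s z≤n
      ... | other p q rewrite ≈ᵇ-≢ (p ∘ sym) | ≈ᵇ-≢ (q ∘ sym) with M w ≟ w | N w ≟ w | t ≟ w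
      ...   | yes _ | _     | _     = z≤n
      ...   | no _  | no _  | _     = s≤s z≤n
      ...   | no _  | yes _ | yes _ = s≤s z≤n
      ...   | no r  | yes s | no z  = contradiction (w , r , s , z ∘ sym) none
      cov≤ : cov M + 2 ≤ cov N + 1
      cov≤ = begin
        cov M + 2
          ≡⟨ cong (cov M +_) (sym (cong₂ _+_ (countF-≈ᵇ u) (countF-≈ᵇ v))) ⟩
        cov M + (countF (u ≈ᵇ_) + countF (v ≈ᵇ_))
          ≡⟨ cong (cov M +_) (sym (sumF-+ (ind ∘ (u ≈ᵇ_)) _)) ⟩
        cov M + sumF (λ w → ind (u ≈ᵇ w) + ind (v ≈ᵇ w))
          ≡⟨ sym (sumF-+ (ind ∘ moved M) _) ⟩
        sumF (λ w → ind (moved M w) + (ind (u ≈ᵇ w) + ind (v ≈ᵇ w)))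
          ≤⟨ sumF-mono point ⟩
        sumF (λ w → ind (moved N w) + ind (t ≈ᵇ w))
          ≡⟨ sumF-+ (ind ∘ moved N) _ ⟩
        cov N + countF (t ≈ᵇ_)
          ≡⟨ cong (cov N +_) (countF-≈ᵇ t) ⟩
        cov N + 1 ∎
        where open ≤-Reasoning
    ... | yes (x , Mx , Nx , x≢t) = continue K fuel
      where
      y = M x
      z = N y
      x≢y : x ≢ y
      x≢y = Mx ∘ sym
      xy : adj G x y ≡ true
      xy = matched-adj G (proj₁ LM) Mx
      -- If `N` missed `y` as well, adding the edge between `x` and `y` would exceed the bound.
      Ny : N y ≢ y
      Ny p = 1+n≰n (≤-trans (n≤1+n _) (≤-trans (≤-reflexive (sym (cov-rematch G N Nx p x≢y)))
        (≤-trans (bd (rematch N x y) (rematch-isMatching G MN Nx p xy)) cN)))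
      x≢z : x ≢ z
      x≢z p = x≢y (trans (sym Nx) (trans (cong N p) (Ninv y)))
      N₁ = unmatch N y
      N' = rematch N₁ x y
      N₁x : N₁ x ≡ x
      N₁x = trans (unmatch-other N y x≢y x≢z) Nx
      N₁y : N₁ y ≡ y
      N₁y = unmatch-fst N y
      M' : IsMatching G N'
      M' = rematch-isMatching G (unmatch-isMatching G MN y) N₁x N₁y xy
      c' : cov N' ≡ cov N
      c' = trans (cov-rematch G N₁ N₁x N₁y x≢y) (sym (cov-unmatch G MN Ny))
      t≢y : t ≢ y
      t≢y refl = Ny Nt
      N't : N' t ≡ t
      N't = trans (rematch-other N₁ (x≢t ∘ sym) t≢y)
        (trans (unmatch-other N y t≢y (λ p → t≢y (trans (sym Nt) (trans (cong N p) (Ninv y))))) Nt)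
      -- Agreement is gained at `x` and cannot drop at `y`, where both maps now give `x`. At `z`
      -- there was none to lose: `M z ≡ y` would force `z ≡ x`.
      point : ∀ w → ind (M w ≈ᵇ N w) + ind (x ≈ᵇ w) ≤ ind (M w ≈ᵇ N' w)
      point w with oneOf x y w
      ... | fst refl rewrite rematch-fst N₁ x≢y | ≈ᵇ-refl y | ≈ᵇ-refl x | Nx | ≈ᵇ-≢ (x≢y ∘ sym) = ≤-refl
      ... | snd refl rewrite rematch-snd N₁ {x} {y} | Minv x | ≈ᵇ-refl x | ≈ᵇ-≢ x≢y
        = ≤-trans (≤-reflexive (+-identityʳ _)) (ind≤1 _)
      ... | other p q rewrite rematch-other N₁ p q | ≈ᵇ-≢ (p ∘ sym) with oneOf y z w
      ...   | fst r = contradiction r q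
      ...   | snd refl rewrite Ninv y | ≈ᵇ-≢ (λ (s : M z ≡ y) → x≢z (trans (sym (Minv x)) (trans (cong M (sym s)) (Minv z)))) = z≤n
      ...   | other r s rewrite unmatch-other N y r s = ≤-reflexive (+-identityʳ _)
      agr : agreement N + 1 ≤ agreement N'
      agr = ≤-trans (≤-reflexive (trans (cong (agreement N +_) (sym (countF-≈ᵇ x)))
        (sym (sumF-+ (λ w → ind (M w ≈ᵇ N w)) _)))) (sumF-mono point)
      continue : ∀ K → n G ≤ agreement N + K → ⊥
      continue zero p = 1+n≰n (≤-trans (s≤s p) (≤-trans (≤-reflexive (trans (cong suc (+-identityʳ _)) (+-comm 1 _)))
        (≤-trans agr (countF-≤ (λ w → M w ≈ᵇ N' w)))))
      continue (suc K) p = go K N' (M' , ≤-trans cN (≤-reflexive (sym c'))) N't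
        (≤-trans p (≤-trans (≤-reflexive (sym (+-assoc (agreement N) 1 K))) (+-monoˡ-≤ K agr)))

does⁻ : ∀ {A : Set} (a? : Dec A) → does a? ≡ true → A
does⁻ (yes a) _  = a
does⁻ (no _)  ()

module _ (G : Graph) (ν : ℕ) (bounded : Bounded G (suc ν)) where

  private
    V = Fin (n G)
    L = Large G (suc ν)

  module AllMissed (missed : ∀ v → Missing G (suc ν) v v) where

    -- Equality is added for reflexivity, since here every vertex satisfies `Missing v v`.
    -- Transitivity is Gallai's lemma.
    Related : V → V → Set
    Related u w = u ≡ w ⊎ ¬ Missing G (suc ν) u w

    related? : ∀ u w → Dec (Related u w)
    related? u w = (u ≟ w) ⊎-dec ¬? (missing? G (suc ν) u w)

    -- A maximum matching that misses both ends of an edge could be enlarged by this edge.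
    adj⇒related : ∀ {u w} → adj G u w ≡ true → Related u w
    adj⇒related {u} {w} uw = inj₂ λ (m , (M , c) , mu , mw) → 1+n≰n (≤-trans (n≤1+n _)
      (≤-trans (s≤s (s≤s c)) (≤-trans (≤-reflexive (sym (cov-rematch G m mu mw (adj⇒≢ G uw))))
        (bounded _ (rematch-isMatching G M mu mw uw)))))

    related-trans : ∀ {u t v} → Related u t → Related t v → Related u v
    related-trans (inj₁ refl) r = r
    related-trans (inj₂ p) (inj₁ refl) = inj₂ p
    related-trans {u} {t} {v} (inj₂ p) (inj₂ q) with u ≟ v
    ... | yes u≡v = inj₁ u≡v
    ... | no u≢v  = inj₂ (gallai G (suc ν) bounded u≢v p q (missed t))

    module Class (v₀ : V) (v₀-edge : ∃ λ j → adj G v₀ j ≡ true) where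

      opaque
        C : V → Bool
        C w = does (related? v₀ w)

        C⁺ : ∀ {w} → Related v₀ w → C w ≡ true
        C⁺ {w} = dec-true (related? v₀ w)

        C⁻ : ∀ {w} → C w ≡ true → Related v₀ w
        C⁻ {w} = does⁻ (related? v₀ w)

      closed : ∀ {i j} → C i ≡ true → adj G i j ≡ true → C j ≡ true
      closed ci ij = C⁺ (related-trans (C⁻ ci) (adj⇒related ij))

      N : V → V
      N = proj₁ (missed v₀)

      LN : L N
      LN = proj₁ (proj₂ (missed v₀))

      MN : IsMatching G N
      MN = proj₁ LN

      Nv₀ : N v₀ ≡ v₀
      Nv₀ = proj₁ (proj₂ (proj₂ (missed v₀)))

      -- `N` is a maximum matching that misses `v₀`, so it cannot miss a second vertex of the class.
      -- It pairs up the class without `v₀`, which makes the order of the class odd.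
      N-moves : ∀ {w} → C w ≡ true → w ≢ v₀ → N w ≢ w
      N-moves cw w≢v₀ Nw with C⁻ cw
      ... | inj₁ p = w≢v₀ (sym p)
      ... | inj₂ r = r (N , LN , Nv₀ , Nw)

      C-N : ∀ {w} → C w ≡ true → C (N w) ≡ true
      C-N {w} cw with proj₂ MN w
      ... | inj₁ p = trans (cong C p) cw
      ... | inj₂ a = closed cw a

      edge : ∀ {w} → C w ≡ true → ∃ λ j → adj G w j ≡ true
      edge {w} cw with w ≟ v₀
      ... | yes refl = v₀-edge
      ... | no w≢v₀  = N w , matched-adj G MN (N-moves cw w≢v₀)

      -- `N` respects the class, so it can be combined with any matching `m` outside. The result is
      -- bounded in `G`, which leaves at most `suc ν ∸ k` edges for `m`.
      splice : (V → V) → V → V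
      splice m w = if C w then N w else m w

      splice-isMatching : ∀ {m} → IsMatching (restrict G (not ∘ C)) m → IsMatching G (splice m)
      splice-isMatching {m} M@(inv , e) = inv' , e'
        where
        stays : ∀ {w} → C w ≡ false → C (m w) ≡ false
        stays {w} cw with e w
        ... | inj₁ p = trans (cong C p) cw
        ... | inj₂ a with C (m w) | proj₁ (proj₂ (restrict⁻ G (not ∘ C) {w} a))
        ...   | false | _ = refl
        inv' : ∀ w → splice m (splice m w) ≡ w
        inv' w with C w in cw
        ... | true  rewrite C-N cw   = proj₁ MN w
        ... | false rewrite stays cw = inv w
        e' : ∀ w → splice m w ≡ w ⊎ adj G w (splice m w) ≡ true
        e' w with C w
        ... | true  = proj₂ MN w
        ... | false = proj₂ (restrict-matching G (not ∘ C) M) w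

      inner : V → V
      inner = splice id

      cov-splice : ∀ {m} → IsMatching (restrict G (not ∘ C)) m → cov (splice m) ≡ cov inner + cov m
      cov-splice {m} M = trans (sumF-cong point) (sumF-+ (ind ∘ moved inner) (ind ∘ moved m))
        where
        point : ∀ w → ind (moved (splice m) w) ≡ ind (moved inner w) + ind (moved m w)
        point w with C w in cw
        ... | true rewrite moved-fix {m = m} (restrict-fixed G (not ∘ C) M {w} (cong not cw)) = sym (+-identityʳ _)
        ... | false rewrite ≈ᵇ-refl w = refl

      count-C : countF C ≡ suc (cov inner)
      count-C = trans (sumF-cong point) (trans (sumF-+ (ind ∘ (v₀ ≈ᵇ_)) _) (cong (_+ cov inner) (countF-≈ᵇ v₀)))
        where
        C-v₀ : C v₀ ≡ true
        C-v₀ = C⁺ (inj₁ refl)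
        point : ∀ w → ind (C w) ≡ ind (v₀ ≈ᵇ w) + ind (moved inner w)
        point w with v₀ ≟ w
        ... | yes refl rewrite C-v₀ | Nv₀ | ≈ᵇ-refl v₀ = refl
        ... | no v₀≢w with C w in cw
        ...   | true  rewrite ≈ᵇ-≢ (N-moves cw (v₀≢w ∘ sym)) = refl
        ...   | false rewrite ≈ᵇ-refl w = refl

      inner-isMatching : IsMatching G inner
      inner-isMatching = splice-isMatching (id-isMatching (restrict G (not ∘ C)))

      decomposition : Decomposition G ν
      decomposition with matching⇒HasMatching G inner-isMatching
      ... | k , ck , _ = component C k 1≤k (double-cancel-≤ (≤-trans (≤-reflexive (sym ck)) (bounded inner inner-isMatching)))
                           (trans count-C (cong suc ck)) closed edge rest
        where
        j = proj₁ v₀-edge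
        v₀≢j : v₀ ≢ j
        v₀≢j = adj⇒≢ G (proj₂ v₀-edge)
        Cj : C j ≡ true
        Cj = C⁺ (adj⇒related (proj₂ v₀-edge))
        inner-j : inner j ≢ j
        inner-j p rewrite Cj = N-moves Cj (v₀≢j ∘ sym) p
        positive : ∀ l → cov inner ≡ l + l → 1 ≤ l
        positive (suc _) _ = s≤s z≤n
        positive zero    c = contradiction (≤-trans (countF-pos (moved inner) {j} (moved-≢ {m = inner} inner-j)) (≤-reflexive c)) 1+n≰n
        1≤k : 1 ≤ k
        1≤k = positive k ck
        rest : Bounded (restrict G (not ∘ C)) (suc ν ∸ k)
        rest m M = begin
          cov m                                ≡⟨ sym (m+n∸m≡n (cov inner) (cov m)) ⟩
          cov inner + cov m ∸ cov inner        ≡⟨ cong₂ _∸_ (sym (cov-splice M)) ck ⟩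
          cov (splice m) ∸ (k + k)             ≤⟨ ∸-monoˡ-≤ (k + k) (bounded (splice m) (splice-isMatching M)) ⟩
          suc ν + suc ν ∸ (k + k)              ≡⟨ double-∸ (suc ν) k ⟩
          (suc ν ∸ k) + (suc ν ∸ k)            ∎
          where
          open ≤-Reasoning
          double-∸ : ∀ a b → a + a ∸ (b + b) ≡ (a ∸ b) + (a ∸ b)
          double-∸ a zero = refl
          double-∸ zero (suc b) = refl
          double-∸ (suc a) (suc b) rewrite +-suc a a | +-suc b b = double-∸ a b

  decompose : Decomposition G ν
  decompose with all? (λ v → missing? G (suc ν) v v)
  ... | no ¬all with ¬∀⟶∃¬ (n G) _ (λ v → missing? G (suc ν) v v) ¬all
  -- A large matching of the graph without `v` would be a large matching of `G` that misses `v`.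
  ...   | v , ¬v = essential v λ m M →
                     let M' = restrict-matching G (λ i → not (v ≈ᵇ i)) M
                         fixed = restrict-fixed G (λ i → not (v ≈ᵇ i)) M (cong not (≈ᵇ-refl v))
                     in cov-parity G M' λ c → ¬v (m , (M' , c) , fixed , fixed)
  decompose | yes all with search L (Large-resp G (suc ν)) (Large? G (suc ν))
  -- Every vertex is missed by some large matching, so this case arises only when there is no vertex
  -- at all.
  ... | no none = slack λ m M → cov-parity G M λ c → none (m , M , c)
  ... | yes (m , M , c) with countF-witness (moved m) (≤-trans (s≤s z≤n) c)
  ...   | v , mv = AllMissed.Class.decomposition all v (m v , matched-adj G M (moved⁻ {m = m} mv))

-- The Chvátal–Hanson bound

degree-witness : ∀ G {v} → 1 ≤ degree G v → ∃ λ j → adj G v j ≡ true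
degree-witness G {v} = countF-witness (adj G v)

degree-restrict-≤ : ∀ G C i → degree (restrict G C) i ≤ degree G i
degree-restrict-≤ G C i = countF-mono (adj (restrict G C) i) (adj G i) (λ j p → proj₂ (proj₂ (restrict⁻ G C {i} p)))

degree-restrict-0 : ∀ G C {i} → C i ≡ false → degree (restrict G C) i ≡ 0
degree-restrict-0 G C {i} ci = countF-none (adj (restrict G C) i) none
  where
  none : ∀ j → (C i ∧ C j) ∧ adj G i j ≡ false
  none j rewrite ci = refl

degreeSum-partition : ∀ G C → (∀ {i j} → C i ≡ true → adj G i j ≡ true → C j ≡ true) →
  degreeSum G ≡ degreeSum (restrict G C) + degreeSum (restrict G (not ∘ C))
degreeSum-partition G C closed = trans
  (sumF-cong λ i → trans (sumF-cong (point i)) (sumF-+ (λ j → ind (adj (restrict G C) i j)) _))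
  (sumF-+ (degree (restrict G C)) _)
  where
  crossing : ∀ {i j} → C i ≡ true → C j ≡ false → adj G i j ≡ false
  crossing ci cj = ¬-not λ a → true≢false (closed ci a) cj
  point : ∀ i j → ind (adj G i j) ≡ ind ((C i ∧ C j) ∧ adj G i j) + ind ((not (C i) ∧ not (C j)) ∧ adj G i j)
  point i j with C i in ci | C j in cj
  ... | true  | true  = sym (+-identityʳ _)
  ... | true  | false rewrite crossing ci cj = refl
  ... | false | true  rewrite adj-sym G i j | crossing cj ci = refl
  ... | false | false = refl

degreeSum-delete : ∀ G v → degreeSum G ≡ degreeSum (delete G v) + (degree G v + degree G v)
degreeSum-delete G v = begin
  degreeSum G
    ≡⟨ sumF-cong (λ i → trans (sumF-cong (point i)) (sumF-+ (λ j → ind (adj (delete G v) i j)) _)) ⟩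
  sumF (λ i → degree (delete G v) i + sumF (λ j → row i j + column i j))
    ≡⟨ sumF-+ (degree (delete G v)) _ ⟩
  degreeSum (delete G v) + sumF (λ i → sumF (λ j → row i j + column i j))
    ≡⟨ cong (degreeSum (delete G v) +_) (sumF-cong (λ i → sumF-+ (row i) (column i))) ⟩
  degreeSum (delete G v) + sumF (λ i → sumF (row i) + sumF (column i))
    ≡⟨ cong (degreeSum (delete G v) +_) (trans (sumF-+ (λ i → sumF (row i)) _) (cong₂ _+_ rows columns)) ⟩
  degreeSum (delete G v) + (degree G v + degree G v) ∎
  where
  open ≡-Reasoning
  row column : Fin (n G) → Fin (n G) → ℕ
  row i j    = if v ≈ᵇ i then ind (adj G v j) else 0
  column i j = if v ≈ᵇ j then ind (adj G v i) else 0
  point : ∀ i j → ind (adj G i j) ≡ ind ((not (v ≈ᵇ i) ∧ not (v ≈ᵇ j)) ∧ adj G i j) + (row i j + column i j)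
  point i j with v ≟ i | v ≟ j
  ... | yes refl | yes refl rewrite adj-irrefl G v = refl
  ... | yes refl | no _     = sym (+-identityʳ _)
  ... | no _     | yes refl = cong ind (adj-sym G i j)
  ... | no _     | no _     = sym (+-identityʳ _)
  rows : sumF (λ i → sumF (row i)) ≡ degree G v
  rows = trans (sumF-swap row) (sumF-cong λ j → sumF-pick v (λ _ → ind (adj G v j)))
  columns : sumF (λ i → sumF (column i)) ≡ degree G v
  columns = sumF-cong λ i → sumF-pick v (λ _ → ind (adj G v i))

double-injective : ∀ {a b} → a + a ≡ b + b → a ≡ b
double-injective p = ≤-antisym (double-cancel-≤ (≤-reflexive p)) (double-cancel-≤ (≤-reflexive (sym p)))

edgeCount-partition : ∀ G C → (∀ {i j} → C i ≡ true → adj G i j ≡ true → C j ≡ true) →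
  edgeCount G ≡ edgeCount (restrict G C) + edgeCount (restrict G (not ∘ C))
edgeCount-partition G C closed = double-injective (trans (sym (handshake G)) (trans (degreeSum-partition G C closed)
  (trans (cong₂ _+_ (handshake (restrict G C)) (handshake (restrict G (not ∘ C))))
         (interchange (edgeCount (restrict G C)) (edgeCount (restrict G C)) _ _))))

edgeCount-delete : ∀ G v → edgeCount G ≡ edgeCount (delete G v) + degree G v
edgeCount-delete G v = double-injective (trans (sym (handshake G)) (trans (degreeSum-delete G v)
  (trans (cong (_+ (degree G v + degree G v)) (handshake (delete G v)))
         (interchange (edgeCount (delete G v)) (edgeCount (delete G v)) _ _))))

edgeCount-restrict-≤ : ∀ G C d → (∀ {i} → C i ≡ true → degree (restrict G C) i ≤ d) →
  edgeCount (restrict G C) + edgeCount (restrict G C) ≤ countF C * d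
edgeCount-restrict-≤ G C d deg≤ = begin
  edgeCount (restrict G C) + edgeCount (restrict G C)  ≡⟨ sym (handshake (restrict G C)) ⟩
  degreeSum (restrict G C)                             ≤⟨ sumF-mono point ⟩
  sumF (λ i → ind (C i) * d)                           ≡⟨ sumF-*ʳ (ind ∘ C) d ⟩
  countF C * d                                         ∎
  where
  open ≤-Reasoning
  point : ∀ i → degree (restrict G C) i ≤ ind (C i) * d
  point i = go (C i) refl
    where
    go : ∀ b → C i ≡ b → degree (restrict G C) i ≤ ind b * d
    go true  e = ≤-trans (deg≤ e) (≤-reflexive (sym (+-identityʳ d)))
    go false e = ≤-reflexive (degree-restrict-0 G C e)

degree-restrict-< : ∀ G C {i k} → countF C ≡ suc k → C i ≡ true → degree (restrict G C) i ≤ k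
degree-restrict-< G C {i} {k} count ci = ≤-trans
  (countF-mono (adj (restrict G C) i) (C ∖ i) (λ j p → let _ , cj , a = restrict⁻ G C {i} p in ∖⁺ C i (adj⇒≢ G a ∘ sym) cj))
  (≤-reflexive (suc-injective (trans (sym (countF-∖ C ci)) count)))

Bounded0⇒edgeless : ∀ G → Bounded G 0 → ∀ i j → adj G i j ≡ false
Bounded0⇒edgeless G b i j = ¬-not λ a → contradiction
  (≤-trans (≤-reflexive (sym (cov-rematch G id refl refl (adj⇒≢ G a))))
    (b (rematch id i j) (rematch-isMatching G (id-isMatching G) refl refl a)))
  (λ ())

edgeless⇒degree0 : ∀ G → (∀ i j → adj G i j ≡ false) → ∀ i → degree G i ≡ 0
edgeless⇒degree0 G none i = countF-none (adj G i) (none i)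

edgeless⇒edgeCount0 : ∀ G → (∀ i j → adj G i j ≡ false) → edgeCount G ≡ 0
edgeless⇒edgeCount0 G none = double-injective (trans (sym (handshake G))
  (trans (sumF-cong (edgeless⇒degree0 G none)) (sumF-0 (n G))))

fdiv-mono : ∀ c {a b} → a ≤ b → fdiv a c ≤ fdiv b c
fdiv-mono zero    _ = z≤n
fdiv-mono (suc c) p = /-monoˡ-≤ (suc c) p

fdiv-∸ : ∀ {c b} → 1 ≤ c → c ≤ b → fdiv b c ≡ suc (fdiv (b ∸ c) c)
fdiv-∸ {suc c} _ p = m/n≡1+[m∸n]/n p

fdiv-< : ∀ {c a} q → 1 ≤ c → a < q * c → fdiv a c < q
fdiv-< {suc c} q _ p = m<n*o⇒m/o<n p

fdiv-* : ∀ {c} q → 1 ≤ c → fdiv (q * c) c ≡ q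
fdiv-* {suc c} q _ = m*n/n≡m q (suc c)

fdiv-small : ∀ {c a} → a < c → fdiv a c ≡ 0
fdiv-small {suc c} p = m<n⇒m/n≡0 p

halve : ∀ {x y} → x + x ≤ suc (y + y) → x ≤ y
halve {x} {y} p with x ≤? y
... | yes q = q
... | no q  = contradiction (≤-trans (≤-trans (≤-reflexive (cong suc (sym (+-suc y y)))) (+-mono-≤ (≰⇒> q) (≰⇒> q))) p) 1+n≰n

-- The inequalities pin down h = ⌊Δ/2⌋ and c = ⌈Δ/2⌉ and turn the parity of Δ into the alternative
-- `c ≡ h` or `c ≡ suc h`.
module Bound (Δ c h : ℕ) (Δ≡ : h + c ≡ Δ) (h≤c : h ≤ c) (c≤1+h : c ≤ suc h) (1≤c : 1 ≤ c) where

  maxEdges : ℕ → ℕ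
  maxEdges ν = Δ * ν + fdiv ν c * h

  -- Since c ≤ h + 1, the degree sum is at most 2Δk + h + c ≤ 2(Δk + h) + 1, and the odd unit
  -- disappears on halving.
  component-≤ : ∀ {x} k → x + x ≤ suc (k + k) * Δ → x ≤ Δ * k + h
  component-≤ {x} k p = halve (begin
    x + x                                ≤⟨ p ⟩
    Δ + (k + k) * Δ                      ≤⟨ +-monoˡ-≤ _ (≤-trans (≤-reflexive (sym Δ≡)) (+-monoʳ-≤ h c≤1+h)) ⟩
    h + suc h + (k + k) * Δ              ≡⟨ arith h k Δ ⟩
    suc (Δ * k + h + (Δ * k + h))        ∎)
    where
    open ≤-Reasoning
    arith : ∀ h k d → h + suc h + (k + k) * d ≡ suc (d * k + h + (d * k + h))
    arith = solve-∀

  -- For k < c there are too few vertices: k ≤ h and k + 1 ≤ c give 2k + 1 ≤ Δ, so even the complete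
  -- graph has only k(2k + 1) ≤ Δk edges.
  component-<-≤ : ∀ {x k} → k < c → x + x ≤ suc (k + k) * (k + k) → x ≤ Δ * k
  component-<-≤ {x} {k} k<c p = double-cancel-≤ (begin
    x + x                      ≤⟨ p ⟩
    suc (k + k) * (k + k)      ≤⟨ *-monoˡ-≤ (k + k) odd≤Δ ⟩
    Δ * (k + k)                ≡⟨ *-distribˡ-+ Δ k k ⟩
    Δ * k + Δ * k              ∎)
    where
    open ≤-Reasoning
    odd≤Δ : suc (k + k) ≤ Δ
    odd≤Δ = ≤-trans (≤-reflexive (sym (+-suc k k)))
      (≤-trans (+-mono-≤ (≤-pred (≤-trans k<c c≤1+h)) k<c) (≤-reflexive Δ≡))

  maxEdges-suc : ∀ ν → maxEdges ν + Δ ≤ maxEdges (suc ν)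
  maxEdges-suc ν = ≤-trans (≤-reflexive (arith Δ ν _))
    (+-monoʳ-≤ (Δ * suc ν) (*-monoˡ-≤ h (fdiv-mono c (n≤1+n ν))))
    where
    arith : ∀ d v x → d * v + x + d ≡ d * suc v + x
    arith = solve-∀

  slope : ∀ {ν k} → k ≤ ν → Δ * k + Δ * (ν ∸ k) ≡ Δ * ν
  slope {ν} {k} k≤ν = trans (sym (*-distribˡ-+ Δ k _)) (cong (Δ *_) (m+[n∸m]≡n k≤ν))

  maxEdges-small : ∀ {ν k} → k ≤ ν → Δ * k + maxEdges (ν ∸ k) ≤ maxEdges ν
  maxEdges-small {ν} {k} k≤ν = ≤-trans (≤-reflexive (trans (sym (+-assoc (Δ * k) _ _)) (cong (_+ fdiv (ν ∸ k) c * h) (slope k≤ν))))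
    (+-monoʳ-≤ (Δ * ν) (*-monoˡ-≤ h (fdiv-mono c (m∸n≤m ν k))))

  -- Removing at least c from ν lowers the floor by at least one, which pays for the additional h
  -- edges of the class.
  maxEdges-large : ∀ {ν k} → c ≤ k → k ≤ ν → Δ * k + h + maxEdges (ν ∸ k) ≤ maxEdges ν
  maxEdges-large {ν} {k} c≤k k≤ν = begin
    Δ * k + h + (Δ * (ν ∸ k) + fdiv (ν ∸ k) c * h)  ≡⟨ interchange (Δ * k) h _ _ ⟩
    Δ * k + Δ * (ν ∸ k) + suc (fdiv (ν ∸ k) c) * h  ≤⟨ +-mono-≤ (≤-reflexive (slope k≤ν))
      (*-monoˡ-≤ h (≤-trans (s≤s (fdiv-mono c (∸-monoʳ-≤ ν c≤k))) (≤-reflexive (sym (fdiv-∸ 1≤c (≤-trans c≤k k≤ν)))))) ⟩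
    Δ * ν + fdiv ν c * h                            ∎
    where open ≤-Reasoning

  module Component (G : Graph) (deg≤ : ∀ i → degree G i ≤ Δ) (C : Fin (n G) → Bool) (k : ℕ)
                   (count : countF C ≡ suc (k + k)) where

    inside : ℕ
    inside = edgeCount (restrict G C)

    inside-≤ : inside ≤ Δ * k + h
    inside-≤ = component-≤ k (subst (λ z → inside + inside ≤ z * Δ) count
      (edgeCount-restrict-≤ G C Δ (λ {i} _ → ≤-trans (degree-restrict-≤ G C i) (deg≤ i))))

    inside-<-≤ : k < c → inside ≤ Δ * k
    inside-<-≤ k<c = component-<-≤ k<c (subst (λ z → inside + inside ≤ z * (k + k)) count
      (edgeCount-restrict-≤ G C (k + k) (degree-restrict-< G C count)))

  edgeCount-≤ : ∀ ν G → (∀ i → degree G i ≤ Δ) → Bounded G ν → edgeCount G ≤ maxEdges ν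
  edgeCount-≤ ν = go ν ν ≤-refl
    where
    -- `K` makes this a strong induction, because a class lowers ν by an arbitrary k ≥ 1.
    go : ∀ K ν → ν ≤ K → ∀ G → (∀ i → degree G i ≤ Δ) → Bounded G ν → edgeCount G ≤ maxEdges ν
    go _ zero _ G _ b = ≤-trans (≤-reflexive (edgeless⇒edgeCount0 G (Bounded0⇒edgeless G b))) z≤n
    go (suc K) (suc ν) (s≤s ν≤K) G deg≤ b with decompose G ν b
    ... | slack b' = ≤-trans (go K ν ν≤K G deg≤ b') (≤-trans (m≤m+n _ Δ) (maxEdges-suc ν))
    ... | essential v b' = begin
      edgeCount G                          ≡⟨ edgeCount-delete G v ⟩
      edgeCount (delete G v) + degree G v  ≤⟨ +-mono-≤ (go K ν ν≤K (delete G v)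
        (λ i → ≤-trans (degree-restrict-≤ G (λ j → not (v ≈ᵇ j)) i) (deg≤ i)) b') (deg≤ v) ⟩
      maxEdges ν + Δ                       ≤⟨ maxEdges-suc ν ⟩
      maxEdges (suc ν)                     ∎
      where open ≤-Reasoning
    ... | component C k 1≤k k≤ν count closed _ b' = ≤-trans (≤-reflexive (edgeCount-partition G C closed)) total
      where
      open Component G deg≤ C k count
      outside-≤ : edgeCount (restrict G (not ∘ C)) ≤ maxEdges (suc ν ∸ k)
      outside-≤ = go K (suc ν ∸ k) (≤-trans (∸-monoʳ-≤ (suc ν) 1≤k) ν≤K) (restrict G (not ∘ C))
        (λ i → ≤-trans (degree-restrict-≤ G (not ∘ C) i) (deg≤ i)) b'
      total : inside + edgeCount (restrict G (not ∘ C)) ≤ maxEdges (suc ν)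
      total with c ≤? k
      ... | yes c≤k = ≤-trans (+-mono-≤ inside-≤ outside-≤) (maxEdges-large c≤k k≤ν)
      ... | no c≰k  = ≤-trans (+-mono-≤ (inside-<-≤ (≰⇒> c≰k)) outside-≤) (maxEdges-small k≤ν)

-- Cotrees

-- Cotrees: `glue false` is the disjoint union and `glue true` the join. Two graphs that realize the
-- same term are isomorphic, so uniqueness reduces to reading off a term.
data Shape : Set where
  nil dot : Shape
  glue      : Bool → Shape → Shape → Shape

⟦_⟧ : Shape → Set
⟦ nil ⟧        = ⊥
⟦ dot ⟧      = ⊤
⟦ glue _ s t ⟧ = ⟦ s ⟧ ⊎ ⟦ t ⟧

shapeAdj : ∀ s → ⟦ s ⟧ → ⟦ s ⟧ → Bool
shapeAdj dot        _        _        = false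
shapeAdj (glue b s t) (inj₁ x) (inj₁ y) = shapeAdj s x y
shapeAdj (glue b s t) (inj₁ x) (inj₂ y) = b
shapeAdj (glue b s t) (inj₂ x) (inj₁ y) = b
shapeAdj (glue b s t) (inj₂ x) (inj₂ y) = shapeAdj t x y

homogeneous : Bool → ℕ → Shape
homogeneous b zero    = nil
homogeneous b (suc m) = glue b dot (homogeneous b m)

-- For `false` these are p disjoint edges, for `true` their complement, the cocktail party graph.
pairs : Bool → ℕ → Shape
pairs b zero    = nil
pairs b (suc p) = glue b (glue (not b) dot dot) (pairs b p)

copies : ℕ → Shape → Shape
copies zero    s = nil
copies (suc q) s = glue false s (copies q s)

-- Relative to a predicate on the vertices, so that parts of one graph can be described separately
-- and then glued.
record Realizes (G : Graph) (P : Fin (n G) → Set) (s : Shape) : Set where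
  field
    emb     : ⟦ s ⟧ → Fin (n G)
    emb∈    : ∀ x → P (emb x)
    cover   : ∀ {v} → P v → ∃ λ x → emb x ≡ v
    emb-inj : ∀ {x y} → emb x ≡ emb y → x ≡ y
    adj-emb : ∀ x y → adj G (emb x) (emb y) ≡ shapeAdj s x y

open Realizes

realizes⇒isomorphic : ∀ {G H P Q s} → (∀ v → P v) → (∀ w → Q w) → Realizes G P s → Realizes H Q s → Isomorphic G H
realizes⇒isomorphic {G} {H} {P} {Q} {s} allP allQ R S =
  mk↔ₛ′ (λ v → emb S (locate R allP v)) (λ w → emb R (locate S allQ w)) (back S R allQ allP) (back R S allP allQ) , preserves
  where
  locate : ∀ {K P} → Realizes K P s → (∀ v → P v) → Fin (n K) → ⟦ s ⟧
  locate R all v = proj₁ (cover R (all v))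
  back : ∀ {K L P Q} (R : Realizes K P s) (S : Realizes L Q s) (p : ∀ v → P v) (q : ∀ w → Q w) v →
    emb R (locate S q (emb S (locate R p v))) ≡ v
  back R S p q v = trans (cong (emb R) (emb-inj S (proj₂ (cover S (q _))))) (proj₂ (cover R (p v)))
  preserves : ∀ i j → adj G i j ≡ adj H (emb S (locate R allP i)) (emb S (locate R allP j))
  preserves i j = trans (cong₂ (adj G) (sym (proj₂ (cover R (allP i)))) (sym (proj₂ (cover R (allP j)))))
    (trans (adj-emb R _ _) (sym (adj-emb S _ _)))

module _ {G : Graph} where

  private V = Fin (n G)

  realizes-nil : ∀ {P} → (∀ v → ¬ P v) → Realizes G P nil
  realizes-nil none = record
    { emb = λ () ; emb∈ = λ () ; cover = λ {v} p → ⊥-elim (none v p) ; emb-inj = λ { {()} } ; adj-emb = λ () }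

  realizes-dot : ∀ a → Realizes G (_≡ a) dot
  realizes-dot a = record
    { emb = λ _ → a ; emb∈ = λ _ → refl ; cover = λ p → tt , sym p ; emb-inj = λ _ → refl
    ; adj-emb = λ _ _ → adj-irrefl G a }

  realizes-glue : ∀ {P Q R : V → Set} {b s t} → Realizes G P s → Realizes G Q t →
    (∀ {v} → R v → P v ⊎ Q v) → (∀ {v} → P v → R v) → (∀ {v} → Q v → R v) →
    (∀ {v} → P v → Q v → ⊥) → (∀ {u v} → P u → Q v → adj G u v ≡ b) → Realizes G R (glue b s t)
  realizes-glue {P} {Q} {R} {b} {s} {t} X Y split P⊆R Q⊆R disjoint cross = record
    { emb     = embed
    ; emb∈    = λ { (inj₁ x) → P⊆R (emb∈ X x) ; (inj₂ y) → Q⊆R (emb∈ Y y) }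
    ; cover   = λ r → [ (λ p → let x , e = cover X p in inj₁ x , e) , (λ q → let y , e = cover Y q in inj₂ y , e) ]′ (split r)
    ; emb-inj = λ {x} {y} → inj x y
    ; adj-emb = adjacent
    }
    where
    embed : ⟦ s ⟧ ⊎ ⟦ t ⟧ → V
    embed = [ emb X , emb Y ]′
    inj : ∀ x y → embed x ≡ embed y → x ≡ y
    inj (inj₁ x) (inj₁ y) e = cong inj₁ (emb-inj X e)
    inj (inj₁ x) (inj₂ y) e = ⊥-elim (disjoint (emb∈ X x) (subst Q (sym e) (emb∈ Y y)))
    inj (inj₂ x) (inj₁ y) e = ⊥-elim (disjoint (emb∈ X y) (subst Q e (emb∈ Y x)))
    inj (inj₂ x) (inj₂ y) e = cong inj₂ (emb-inj Y e)
    adjacent : ∀ x y → adj G (embed x) (embed y) ≡ shapeAdj (glue b s t) x y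
    adjacent (inj₁ x) (inj₁ y) = adj-emb X x y
    adjacent (inj₁ x) (inj₂ y) = cross (emb∈ X x) (emb∈ Y y)
    adjacent (inj₂ x) (inj₁ y) = trans (adj-sym G _ _) (cross (emb∈ X y) (emb∈ Y x))
    adjacent (inj₂ x) (inj₂ y) = adj-emb Y x y

  realizes-restrict : ∀ C {P s} → (∀ {v} → P v → C v ≡ true) → Realizes (restrict G C) P s → Realizes G P s
  realizes-restrict C P⊆C R = record
    { emb = emb R ; emb∈ = emb∈ R ; cover = cover R ; emb-inj = emb-inj R
    ; adj-emb = λ x y → trans (inside (P⊆C (emb∈ R x)) (P⊆C (emb∈ R y))) (adj-emb R x y) }
    where
    inside : ∀ {i j} → C i ≡ true → C j ≡ true → adj G i j ≡ (C i ∧ C j) ∧ adj G i j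
    inside ci cj rewrite ci | cj = refl

  realizes-pair : ∀ {b u w} → u ≢ w → adj G u w ≡ b → Realizes G (λ v → v ≡ u ⊎ v ≡ w) (glue b dot dot)
  realizes-pair {u = u} {w} u≢w uw = realizes-glue (realizes-dot u) (realizes-dot w) id inj₁ inj₂
    (λ { refl p → u≢w p }) (λ { refl refl → uw })

  realizes-homogeneous : ∀ {b} m (S : V → Bool) → countF S ≡ m →
    (∀ {i j} → S i ≡ true → S j ≡ true → i ≢ j → adj G i j ≡ b) →
    Realizes G (λ v → S v ≡ true) (homogeneous b m)
  realizes-homogeneous zero S count same = realizes-nil λ v s → true≢false s (countF≡0 S count v)
  realizes-homogeneous (suc m) S count same with countF-suc S count
  ... | a , sa , count' = realizes-glue (realizes-dot a)
    (realizes-homogeneous m (S ∖ a) count' (λ p q → same (proj₂ (∖⁻ S a p)) (proj₂ (∖⁻ S a q))))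
    split (λ { refl → sa }) (λ p → proj₂ (∖⁻ S a p)) (λ { refl p → proj₁ (∖⁻ S a p) refl })
    (λ { refl p → same sa (proj₂ (∖⁻ S a p)) (proj₁ (∖⁻ S a p) ∘ sym) })
    where
    split : ∀ {v} → S v ≡ true → v ≡ a ⊎ (S ∖ a) v ≡ true
    split {v} sv with v ≟ a
    ... | yes p = inj₁ p
    ... | no p  = inj₂ (∖⁺ S a p sv)

  realizes-pairs : ∀ {b} p (S : V → Bool) → countF S ≡ p + p →
    (∀ {v} → S v ≡ true → ∃ λ w → S w ≡ true × w ≢ v × adj G v w ≡ not b ×
      (∀ {u} → S u ≡ true → u ≢ v → u ≢ w → adj G v u ≡ b)) →
    Realizes G (λ v → S v ≡ true) (pairs b p)
  realizes-pairs zero S count partner = realizes-nil λ v s → true≢false s (countF≡0 S count v)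
  realizes-pairs {b} (suc p) S count partner with countF-suc S count
  ... | x , sx , count' with partner sx
  ... | y , sy , y≢x , xy , x-rest = realizes-glue (realizes-pair (y≢x ∘ sym) xy)
      (realizes-pairs p T (suc-injective (trans (sym (countF-∖ (S ∖ x) (∖⁺ S x y≢x sy))) (trans count' (+-suc p p)))) partner')
      split (λ { (inj₁ refl) → sx ; (inj₂ refl) → sy }) (λ t → proj₁ (T⁻ t))
      (λ { (inj₁ refl) t → proj₁ (proj₂ (T⁻ t)) refl ; (inj₂ refl) t → proj₂ (proj₂ (T⁻ t)) refl })
      (λ { (inj₁ refl) t → x-rest (proj₁ (T⁻ t)) (proj₁ (proj₂ (T⁻ t))) (proj₂ (proj₂ (T⁻ t)))
         ; (inj₂ refl) t → y-rest (proj₁ (T⁻ t)) (proj₁ (proj₂ (T⁻ t))) (proj₂ (proj₂ (T⁻ t))) })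
    where
    T = S ∖ x ∖ y
    T⁻ : ∀ {v} → T v ≡ true → S v ≡ true × v ≢ x × v ≢ y
    T⁻ t with ∖⁻ (S ∖ x) y t
    ... | v≢y , t' with ∖⁻ S x t'
    ...   | v≢x , s = s , v≢x , v≢y
    T⁺ : ∀ {v} → S v ≡ true → v ≢ x → v ≢ y → T v ≡ true
    T⁺ s v≢x v≢y = ∖⁺ (S ∖ x) y v≢y (∖⁺ S x v≢x s)
    split : ∀ {v} → S v ≡ true → (v ≡ x ⊎ v ≡ y) ⊎ T v ≡ true
    split {v} s with oneOf x y v
    ... | fst p     = inj₁ (inj₁ p)
    ... | snd q     = inj₁ (inj₂ q)
    ... | other p q = inj₂ (T⁺ s p q)
    b≢not : ∀ {b c} → c ≡ not b → c ≡ b → ⊥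
    b≢not {true}  refl ()
    b≢not {false} refl ()
    -- The partner of `y` is `x`: with any other partner, `y` would be related to `x` by `b`,
    -- against `xy`.
    y-rest : ∀ {u} → S u ≡ true → u ≢ x → u ≢ y → adj G y u ≡ b
    y-rest {u} su u≢x u≢y with partner sy
    ... | z , sz , z≢y , yz , rest with x ≟ z
    ...   | yes refl = rest su u≢y u≢x
    ...   | no x≢z   = ⊥-elim (b≢not xy (trans (adj-sym G x y) (rest sx (y≢x ∘ sym) x≢z)))
    partner' : ∀ {v} → T v ≡ true → ∃ λ w → T w ≡ true × w ≢ v × adj G v w ≡ not b ×
      (∀ {u} → T u ≡ true → u ≢ v → u ≢ w → adj G v u ≡ b)
    partner' {v} tv with T⁻ tv
    ... | sv , v≢x , v≢y with partner sv
    ...   | w , sw , w≢v , vw , rest = w , T⁺ sw w≢x w≢y , w≢v , vw , λ tu → rest (proj₁ (T⁻ tu))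
      where
      w≢x : w ≢ x
      w≢x refl = b≢not vw (trans (adj-sym G v w) (x-rest sv v≢x v≢y))
      w≢y : w ≢ y
      w≢y refl = b≢not vw (trans (adj-sym G v w) (y-rest sv v≢x v≢y))

-- The structure of extremal graphs

complement : Graph → Graph
complement G = record
  { n      = n G
  ; adj    = λ i j → not (i ≈ᵇ j) ∧ not (adj G i j)
  ; sym    = λ i j → cong₂ (λ a b → not a ∧ not b) (≈ᵇ-sym i j) (adj-sym G i j)
  ; irrefl = λ i → cong (λ a → not a ∧ not (adj G i i)) (≈ᵇ-refl i)
  }

module _ (G : Graph) where

  complement⁺ : ∀ {i j} → i ≢ j → adj G i j ≡ false → adj (complement G) i j ≡ true
  complement⁺ i≢j a rewrite ≈ᵇ-≢ i≢j | a = refl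

  complement-degree : ∀ C {i} → C i ≡ true →
    degree (restrict G C) i + degree (restrict (complement G) C) i + 1 ≡ countF C
  complement-degree C {i} ci = sym (begin
    countF C
      ≡⟨ sumF-cong point ⟩
    sumF (λ j → (inner j + outer j) + ind (i ≈ᵇ j))
      ≡⟨ sumF-+ (λ j → inner j + outer j) _ ⟩
    sumF (λ j → inner j + outer j) + countF (i ≈ᵇ_)
      ≡⟨ cong₂ _+_ (sumF-+ inner outer) (countF-≈ᵇ i) ⟩
    degree (restrict G C) i + degree (restrict (complement G) C) i + 1 ∎)
    where
    open ≡-Reasoning
    inner outer : Fin (n G) → ℕ
    inner j = ind (adj (restrict G C) i j)
    outer j = ind (adj (restrict (complement G) C) i j)
    point : ∀ j → ind (C j) ≡ ind ((C i ∧ C j) ∧ adj G i j) + ind ((C i ∧ C j) ∧ (not (i ≈ᵇ j) ∧ not (adj G i j))) + ind (i ≈ᵇ j)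
    point j rewrite ci with i ≟ j
    ... | yes refl rewrite ci | adj-irrefl G i = refl
    ... | no _ with C j | adj G i j
    ...   | true  | true  = refl
    ...   | true  | false = refl
    ...   | false | _     = refl

  complement-degreeSum : ∀ C →
    degreeSum (restrict G C) + degreeSum (restrict (complement G) C) + countF C ≡ countF C * countF C
  complement-degreeSum C = begin
    degreeSum (restrict G C) + degreeSum (restrict (complement G) C) + countF C
      ≡⟨ cong (_+ countF C) (sym (sumF-+ (degree (restrict G C)) _)) ⟩
    sumF (λ i → degree (restrict G C) i + degree (restrict (complement G) C) i) + countF C
      ≡⟨ sym (sumF-+ (λ i → degree (restrict G C) i + degree (restrict (complement G) C) i) (ind ∘ C)) ⟩
    sumF (λ i → degree (restrict G C) i + degree (restrict (complement G) C) i + ind (C i))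
      ≡⟨ sumF-cong (λ i → point i (C i) refl) ⟩
    sumF (λ i → ind (C i) * countF C)
      ≡⟨ sumF-*ʳ (ind ∘ C) (countF C) ⟩
    countF C * countF C ∎
    where
    open ≡-Reasoning
    point : ∀ i b → C i ≡ b →
      degree (restrict G C) i + degree (restrict (complement G) C) i + ind (C i) ≡ ind (C i) * countF C
    point i true ci = subst Goal (sym ci) (trans (complement-degree C ci) (sym (+-identityʳ _)))
      where
      Goal : Bool → Set
      Goal b = degree (restrict G C) i + degree (restrict (complement G) C) i + ind b ≡ ind b * countF C
    point i false ci = trans (cong₂ (λ x y → x + ind y) (cong₂ _+_ (degree-restrict-0 G C ci) (degree-restrict-0 (complement G) C ci)) ci)
      (cong (λ b → ind b * countF C) (sym ci))

module Extremality (Δ c h : ℕ) (Δ≡ : h + c ≡ Δ) (h≤c : h ≤ c) (c≤1+h : c ≤ suc h) (1≤c : 1 ≤ c) where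

  open Bound Δ c h Δ≡ h≤c c≤1+h 1≤c

  -- For odd Δ the complement is a path on three vertices and a perfect matching on the other 2h.
  blockShape : Dec (c ≡ h) → Shape
  blockShape (yes _) = homogeneous true (suc (c + c))
  blockShape (no _)  = glue true (glue false dot (glue true dot dot)) (pairs true h)

  block : Shape
  block = blockShape (c Data.Nat.≟ h)

  module _ (G : Graph) (deg≤ : ∀ i → degree G i ≤ Δ) (C : Fin (n G) → Bool) (count : countF C ≡ suc (c + c))
           (edges : edgeCount (restrict G C) ≡ Δ * c + h) where

    private
      V  = Fin (n G)
      co = restrict (complement G) C

    co⁺ : ∀ {i j} → C i ≡ true → C j ≡ true → i ≢ j → adj G i j ≡ false → adj co i j ≡ true
    co⁺ {i} {j} ci cj i≢j a = restrict⁺ (complement G) C {i} {j} ci cj (complement⁺ G i≢j a)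

    co⁻ : ∀ {i j} → adj co i j ≡ true → C j ≡ true × i ≢ j × adj G i j ≡ false
    co⁻ {i} {j} p with restrict⁻ (complement G) C {i} p
    ... | _ , cj , q = cj , adj⇒≢ (complement G) q , not-true (proj₂ (∧-true⁻ q))

    co-total : degreeSum co ≡ (c + c + 1) * (c + c) ∸ (Δ * c + h + (Δ * c + h))
    co-total = sym (trans (cong (_∸ (e + e)) total) (m+n∸m≡n (e + e) (degreeSum co)))
      where
      e = Δ * c + h
      total : (c + c + 1) * (c + c) ≡ e + e + degreeSum co
      total = +-cancelʳ-≡ (suc (c + c)) _ _ (trans (arith c) (trans (cong (λ z → z * z) (sym count))
        (trans (sym (complement-degreeSum G C)) (cong₂ (λ x y → x + degreeSum co + y)
          (trans (handshake (restrict G C)) (cong₂ _+_ edges edges)) count))))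
        where
        arith : ∀ c → (c + c + 1) * (c + c) + suc (c + c) ≡ suc (c + c) * suc (c + c)
        arith = solve-∀

    -- Here the class has Δ + 1 vertices and as many edges as the complete graph, so its complement
    -- has degree sum 0.
    even-block : c ≡ h → Realizes G (λ v → C v ≡ true) (homogeneous true (suc (c + c)))
    even-block refl = realizes-homogeneous (suc (c + c)) C count λ {i} {j} ci cj i≢j →
      ¬-not λ a → true≢false (co⁺ ci cj i≢j a) (countF≡0 (adj co i) (sumF≡0 (degree co) co-edgeless i) j)
      where
      arith : ∀ c → (c + c + 1) * (c + c) ≡ (c + c) * c + c + ((c + c) * c + c)
      arith = solve-∀
      co-edgeless : degreeSum co ≡ 0
      co-edgeless = trans co-total (trans (cong₂ _∸_ (arith c) (cong (λ d → d * c + c + (d * c + c)) (sym Δ≡)))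
        (n∸n≡0 ((c + c) * c + c + ((c + c) * c + c))))

    -- The class has Δ + 2 vertices, so each has a non-neighbour in it, and the degree sum of the
    -- complement is only one more than the number of vertices. Hence one vertex `a` has degree 2
    -- there and all others degree 1: a path with middle `a`, and disjoint edges.
    odd-block : c ≡ suc h → Realizes G (λ v → C v ≡ true) (glue true (glue false dot (glue true dot dot)) (pairs true h))
    odd-block refl = Special.realized (proj₁ special) (proj₁ (proj₂ special)) (proj₂ (proj₂ special))
      where
      arith₁ : ∀ h → (suc h + suc h + 1) * (suc h + suc h) ≡
        ((h + suc h) * suc h + h + ((h + suc h) * suc h + h)) + suc (suc (suc h + suc h))
      arith₁ = solve-∀
      co-sum : degreeSum co ≡ suc (suc (c + c))
      co-sum = trans co-total (trans (cong₂ _∸_ (arith₁ h) (cong (λ d → d * c + h + (d * c + h)) (sym Δ≡)))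
        (m+n∸m≡n ((h + suc h) * suc h + h + ((h + suc h) * suc h + h)) _))
      co≥1 : ∀ i → ind (C i) ≤ degree co i
      co≥1 i = go (C i) refl
        where
        go : ∀ b → C i ≡ b → ind b ≤ degree co i
        go false _  = z≤n
        go true  ci = +-cancelˡ-≤ Δ 1 (degree co i) (+-cancelʳ-≤ 1 _ _ (begin
          Δ + 1 + 1                                       ≡⟨ trans (cong (λ d → d + 1 + 1) (sym Δ≡)) (arith₂ h) ⟩
          suc (suc h + suc h)                             ≡⟨ sym count ⟩
          countF C                                        ≡⟨ sym (complement-degree G C ci) ⟩
          degree (restrict G C) i + degree co i + 1       ≤⟨ +-monoˡ-≤ 1 (+-monoˡ-≤ (degree co i)
                                                               (≤-trans (degree-restrict-≤ G C i) (deg≤ i))) ⟩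
          Δ + degree co i + 1                             ∎))
          where
          open ≤-Reasoning
          arith₂ : ∀ h → h + suc h + 1 + 1 ≡ suc (suc h + suc h)
          arith₂ = solve-∀
      special : ∃ λ a → degree co a ≡ suc (ind (C a)) × (∀ i → i ≢ a → ind (C i) ≡ degree co i)
      special = sumF-tight₁ co≥1 (trans co-sum (cong suc (sym count)))
      module Special (a : V) (da : degree co a ≡ suc (ind (C a))) (others : ∀ i → i ≢ a → ind (C i) ≡ degree co i) where
        ca : C a ≡ true
        ca = ¬-not λ e → contradiction (trans (sym da) (degree-restrict-0 (complement G) C e)) (λ ())
        co-a : countF (adj co a) ≡ 2
        co-a = trans da (cong (suc ∘ ind) ca)
        lone : ∀ {i} → C i ≡ true → i ≢ a → ∃ λ w → adj co i w ≡ true × (∀ {u} → adj co i u ≡ true → u ≡ w)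
        lone {i} ci i≢a = countF≡1 (adj co i) (trans (sym (others i i≢a)) (cong ind ci))
        module Ends (b₁ b₂ : V) (a-b₁ : adj co a b₁ ≡ true) (b₂≢b₁ : b₂ ≢ b₁) (a-b₂ : adj co a b₂ ≡ true)
                    (unique₂ : ∀ {j} → (adj co a ∖ b₁) j ≡ true → j ≡ b₂) where
          only-b : ∀ {v} → adj co a v ≡ true → v ≡ b₁ ⊎ v ≡ b₂
          only-b {v} p with v ≟ b₁
          ... | yes q = inj₁ q
          ... | no q  = inj₂ (unique₂ (∖⁺ (adj co a) b₁ q p))
          b-only : ∀ {b} → adj co a b ≡ true → ∀ {v} → adj co b v ≡ true → v ≡ a
          b-only {b} ab bv with lone (proj₁ (co⁻ ab)) (proj₁ (proj₂ (co⁻ ab)) ∘ sym)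
          ... | w , _ , unique = trans (unique bv) (sym (unique (trans (adj-sym co b a) ab)))
          adjacent : ∀ {u v} → C u ≡ true → C v ≡ true → u ≢ v → ¬ (adj co u v ≡ true) → adj G u v ≡ true
          adjacent cu cv u≢v no-co = ¬-not λ x → no-co (co⁺ cu cv u≢v x)
          cb₁ = proj₁ (co⁻ a-b₁)
          cb₂ = proj₁ (co⁻ a-b₂)
          a≢b₁ = proj₁ (proj₂ (co⁻ a-b₁))
          a≢b₂ = proj₁ (proj₂ (co⁻ a-b₂))
          T = C ∖ a ∖ b₁ ∖ b₂
          T⁻ : ∀ {v} → T v ≡ true → C v ≡ true × v ≢ a × v ≢ b₁ × v ≢ b₂
          T⁻ t with ∖⁻ (C ∖ a ∖ b₁) b₂ t
          ... | p , t₁ with ∖⁻ (C ∖ a) b₁ t₁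
          ...   | q , t₂ with ∖⁻ C a t₂
          ...     | r , s = s , r , q , p
          T⁺ : ∀ {v} → C v ≡ true → v ≢ a → v ≢ b₁ → v ≢ b₂ → T v ≡ true
          T⁺ s r q p = ∖⁺ (C ∖ a ∖ b₁) b₂ p (∖⁺ (C ∖ a) b₁ q (∖⁺ C a r s))
          count-T : countF T ≡ h + h
          count-T = suc-injective (suc-injective (suc-injective (trans (sym (trans (countF-∖ C ca) (cong suc (trans
            (countF-∖ (C ∖ a) (∖⁺ C a (a≢b₁ ∘ sym) cb₁)) (cong suc (countF-∖ (C ∖ a ∖ b₁)
              (∖⁺ (C ∖ a) b₁ b₂≢b₁ (∖⁺ C a (a≢b₂ ∘ sym) cb₂)))))))) (trans count (cong (λ z → suc (suc z)) (+-suc h h))))))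
          Triple : V → Set
          Triple v = v ≡ a ⊎ (v ≡ b₁ ⊎ v ≡ b₂)
          triple : Realizes G Triple (glue false dot (glue true dot dot))
          triple = realizes-glue (realizes-dot a)
            (realizes-pair (b₂≢b₁ ∘ sym) (adjacent cb₁ cb₂ (b₂≢b₁ ∘ sym) (λ p → a≢b₂ (sym (b-only a-b₁ p)))))
            id inj₁ inj₂
            (λ { refl (inj₁ p) → a≢b₁ p ; refl (inj₂ p) → a≢b₂ p })
            (λ { refl (inj₁ refl) → proj₂ (proj₂ (co⁻ a-b₁)) ; refl (inj₂ refl) → proj₂ (proj₂ (co⁻ a-b₂)) })
          partner : ∀ {v} → T v ≡ true → ∃ λ w → T w ≡ true × w ≢ v × adj G v w ≡ false ×
            (∀ {u} → T u ≡ true → u ≢ v → u ≢ w → adj G v u ≡ true)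
          partner {v} tv with T⁻ tv
          ... | cv , v≢a , v≢b₁ , v≢b₂ with lone cv v≢a
          ...   | w , vw , unique = w , T⁺ (proj₁ (co⁻ vw)) w≢a (w≢b a-b₁) (w≢b a-b₂) , proj₁ (proj₂ (co⁻ vw)) ∘ sym ,
              proj₂ (proj₂ (co⁻ vw)) , λ tu u≢v u≢w → adjacent cv (proj₁ (T⁻ tu)) (u≢v ∘ sym) (λ p → u≢w (unique p))
            where
            w≢a : w ≢ a
            w≢a p = [ v≢b₁ , v≢b₂ ]′ (only-b (trans (adj-sym co a v) (trans (cong (adj co v) (sym p)) vw)))
            w≢b : ∀ {b} → adj co a b ≡ true → w ≢ b
            w≢b {b} ab p = v≢a (b-only ab (trans (adj-sym co b v) (trans (cong (adj co v) (sym p)) vw)))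
          split : ∀ {v} → C v ≡ true → Triple v ⊎ T v ≡ true
          split {v} cv with v ≟ a | v ≟ b₁ | v ≟ b₂
          ... | yes p | _     | _     = inj₁ (inj₁ p)
          ... | no _  | yes q | _     = inj₁ (inj₂ (inj₁ q))
          ... | no _  | no _  | yes r = inj₁ (inj₂ (inj₂ r))
          ... | no p  | no q  | no r  = inj₂ (T⁺ cv p q r)
          assemble : Realizes G (λ v → C v ≡ true) (glue true (glue false dot (glue true dot dot)) (pairs true h))
          assemble = realizes-glue triple (realizes-pairs h T count-T partner) split
            (λ { (inj₁ refl) → ca ; (inj₂ (inj₁ refl)) → cb₁ ; (inj₂ (inj₂ refl)) → cb₂ })
            (λ t → proj₁ (T⁻ t))
            (λ { (inj₁ refl) t → proj₁ (proj₂ (T⁻ t)) refl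
               ; (inj₂ (inj₁ refl)) t → proj₁ (proj₂ (proj₂ (T⁻ t))) refl
               ; (inj₂ (inj₂ refl)) t → proj₂ (proj₂ (proj₂ (T⁻ t))) refl })
            cross
            where
            cross : ∀ {u v} → Triple u → T v ≡ true → adj G u v ≡ true
            cross {v = v} x t with T⁻ t
            cross (inj₁ refl) t | cv , v≢a , v≢b₁ , v≢b₂ =
              adjacent ca cv (v≢a ∘ sym) (λ p → [ v≢b₁ , v≢b₂ ]′ (only-b p))
            cross (inj₂ (inj₁ refl)) t | cv , v≢a , v≢b₁ , v≢b₂ =
              adjacent cb₁ cv (v≢b₁ ∘ sym) (λ p → v≢a (b-only a-b₁ p))
            cross (inj₂ (inj₂ refl)) t | cv , v≢a , v≢b₁ , v≢b₂ =
              adjacent cb₂ cv (v≢b₂ ∘ sym) (λ p → v≢a (b-only a-b₂ p))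
        realized : Realizes G (λ v → C v ≡ true) (glue true (glue false dot (glue true dot dot)) (pairs true h))
        realized with countF-suc (adj co a) co-a
        ... | b₁ , a-b₁ , one with countF≡1 (adj co a ∖ b₁) one
        ...   | b₂ , p , unique₂ = Ends.assemble b₁ b₂ a-b₁ (proj₁ (∖⁻ (adj co a) b₁ p)) (proj₂ (∖⁻ (adj co a) b₁ p)) unique₂

    realizes-block : Realizes G (λ v → C v ≡ true) block
    realizes-block = go (c Data.Nat.≟ h)
      where
      go : ∀ d → Realizes G (λ v → C v ≡ true) (blockShape d)
      go (yes p) = even-block p
      go (no p)  = odd-block (≤-antisym c≤1+h (≤∧≢⇒< h≤c (p ∘ sym)))

  +-tight : ∀ {a b A B} → a ≤ A → b ≤ B → A + B ≤ a + b → a ≡ A × b ≡ B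
  +-tight {a} {b} {A} {B} a≤A b≤B p =
    ≤-antisym a≤A (+-cancelʳ-≤ b A a (≤-trans (+-monoʳ-≤ A b≤B) p)) ,
    ≤-antisym b≤B (+-cancelˡ-≤ a B b (≤-trans (+-monoˡ-≤ B a≤A) p))

  module _ (p ν : ℕ) (ν≡ : suc p * c ≡ suc ν) where

    top : maxEdges (suc ν) ≡ Δ * suc ν + suc p * h
    top = cong (λ q → Δ * suc ν + q * h) (trans (cong (λ z → fdiv z c) (sym ν≡)) (fdiv-* (suc p) 1≤c))

    -- Here divisibility enters: the floor reaches `suc p` exactly at `suc ν`, so every smaller
    -- argument costs at least one h.
    below : ∀ {x} → x < suc ν → fdiv x c * h + h ≤ suc p * h
    below {x} x<ν = ≤-trans (≤-reflexive (+-comm (fdiv x c * h) h))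
      (*-monoˡ-≤ h (fdiv-< (suc p) 1≤c (≤-trans x<ν (≤-reflexive (sym ν≡)))))

    gap : maxEdges ν + Δ + h ≤ maxEdges (suc ν)
    gap = begin
      maxEdges ν + Δ + h               ≡⟨ arith Δ ν (fdiv ν c * h) h ⟩
      Δ * suc ν + (fdiv ν c * h + h)   ≤⟨ +-monoʳ-≤ (Δ * suc ν) (below ≤-refl) ⟩
      Δ * suc ν + suc p * h            ≡⟨ sym top ⟩
      maxEdges (suc ν)                 ∎
      where
      open ≤-Reasoning
      arith : ∀ d v x h → d * v + x + d + h ≡ d * suc v + (x + h)
      arith = solve-∀

    gap-small : ∀ {k} → 1 ≤ k → k ≤ suc ν → Δ * k + maxEdges (suc ν ∸ k) + h ≤ maxEdges (suc ν)
    gap-small {k} 1≤k k≤ν = begin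
      Δ * k + maxEdges (suc ν ∸ k) + h
        ≡⟨ arith (Δ * k) (Δ * (suc ν ∸ k)) _ h ⟩
      Δ * k + Δ * (suc ν ∸ k) + (fdiv (suc ν ∸ k) c * h + h)
        ≤⟨ +-mono-≤ (≤-reflexive (slope k≤ν)) (below (∸-monoʳ-< 1≤k k≤ν)) ⟩
      Δ * suc ν + suc p * h
        ≡⟨ sym top ⟩
      maxEdges (suc ν) ∎
      where
      open ≤-Reasoning
      arith : ∀ a b x h → a + (b + x) + h ≡ a + b + (x + h)
      arith = solve-∀

    rest : suc ν ∸ c ≡ p * c
    rest = trans (cong (_∸ c) (sym ν≡)) (m+n∸m≡n c (p * c))

    -- A class with k > c leaves less than pc, so the floor falls by two while the class gives back
    -- h only once.
    gap-large : ∀ {k} → c < k → k ≤ suc ν → Δ * k + h + maxEdges (suc ν ∸ k) + h ≤ maxEdges (suc ν)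
    gap-large {k} c<k k≤ν = begin
      Δ * k + h + maxEdges (suc ν ∸ k) + h
        ≡⟨ arith (Δ * k) (Δ * (suc ν ∸ k)) _ h ⟩
      Δ * k + Δ * (suc ν ∸ k) + (h + (h + fdiv (suc ν ∸ k) c * h))
        ≤⟨ +-mono-≤ (≤-reflexive (slope k≤ν)) (+-monoʳ-≤ h (*-monoˡ-≤ h
             (fdiv-< p 1≤c (≤-trans (∸-monoʳ-< c<k k≤ν) (≤-reflexive rest))))) ⟩
      Δ * suc ν + suc p * h
        ≡⟨ sym top ⟩
      maxEdges (suc ν) ∎
      where
      open ≤-Reasoning
      arith : ∀ a b x h → a + h + (b + x) + h ≡ a + b + (h + (h + x))
      arith = solve-∀

    exact : Δ * c + h + maxEdges (p * c) ≡ maxEdges (suc ν)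
    exact = begin
      Δ * c + h + (Δ * (p * c) + fdiv (p * c) c * h)  ≡⟨ cong (λ q → Δ * c + h + (Δ * (p * c) + q * h)) (fdiv-* p 1≤c) ⟩
      Δ * c + h + (Δ * (p * c) + p * h)               ≡⟨ arith Δ c p h ⟩
      Δ * (suc p * c) + suc p * h                     ≡⟨ cong (λ z → Δ * z + suc p * h) ν≡ ⟩
      Δ * suc ν + suc p * h                           ≡⟨ sym top ⟩
      maxEdges (suc ν)                                ∎
      where
      open ≡-Reasoning
      arith : ∀ d c p h → d * c + h + (d * (p * c) + p * h) ≡ d * (suc p * c) + suc p * h
      arith = solve-∀

  -- `S` is the set of vertices with edges: classes already split off remain in the graph as
  -- isolated vertices and must not be counted again. With h ≥ 1 the gaps above are strict and leave
  -- only classes with k = c.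
  realizes-extremal : 1 ≤ h → ∀ q G (S : Fin (n G) → Bool) → (∀ i → degree G i ≤ Δ) → Bounded G (q * c) → edgeCount G ≡ maxEdges (q * c) →
    (∀ {v} → S v ≡ false → degree G v ≡ 0) → (∀ {v} → S v ≡ true → 1 ≤ degree G v) →
    Realizes G (λ v → S v ≡ true) (copies q block)
  realizes-extremal 1≤h zero G S _ bounded _ _ S-edge = realizes-nil λ v s → contradiction
    (≤-trans (S-edge s) (≤-reflexive (edgeless⇒degree0 G (Bounded0⇒edgeless G bounded) v))) (λ ())
  realizes-extremal 1≤h (suc p) G S deg≤ bounded edges S-isolated S-edge with suc p * c in ν≡
  ... | zero = contradiction (≤-trans 1≤c (≤-trans (m≤m+n c (p * c)) (≤-reflexive ν≡))) 1+n≰n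
  ... | suc ν with decompose G ν bounded
  ...   | slack b = contradiction (<-≤-trans (m<m+n (maxEdges ν + Δ) 1≤h) (≤-trans (gap p ν ν≡) (≤-trans
            (≤-reflexive (sym edges)) (≤-trans (edgeCount-≤ ν G deg≤ b) (m≤m+n _ Δ))))) 1+n≰n
  ...   | essential v b = contradiction (<-≤-trans (m<m+n (maxEdges ν + Δ) 1≤h) (≤-trans (gap p ν ν≡) (≤-trans
            (≤-reflexive (trans (sym edges) (edgeCount-delete G v))) (+-mono-≤ (edgeCount-≤ ν (delete G v)
              (λ i → ≤-trans (degree-restrict-≤ G (λ j → not (v ≈ᵇ j)) i) (deg≤ i)) b) (deg≤ v))))) 1+n≰n
  ...   | component C k 1≤k k≤ν count closed C-edge b with <-cmp k c
  ...     | tri< k<c _ _ = contradiction (<-≤-trans (m<m+n _ 1≤h) (≤-trans (gap-small p ν ν≡ 1≤k k≤ν) (≤-trans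
            (≤-reflexive (trans (sym edges) (edgeCount-partition G C closed)))
              (+-mono-≤ (Component.inside-<-≤ G deg≤ C k count k<c)
                (edgeCount-≤ (suc ν ∸ k) (restrict G (not ∘ C)) (λ i → ≤-trans (degree-restrict-≤ G (not ∘ C) i) (deg≤ i)) b))))) 1+n≰n
  ...     | tri> _ _ c<k = contradiction (<-≤-trans (m<m+n _ 1≤h) (≤-trans (gap-large p ν ν≡ c<k k≤ν) (≤-trans
            (≤-reflexive (trans (sym edges) (edgeCount-partition G C closed)))
              (+-mono-≤ (Component.inside-≤ G deg≤ C k count)
                (edgeCount-≤ (suc ν ∸ k) (restrict G (not ∘ C)) (λ i → ≤-trans (degree-restrict-≤ G (not ∘ C) i) (deg≤ i)) b))))) 1+n≰n
  ...     | tri≈ _ refl _ = realizes-glue (realizes-block G deg≤ C count (proj₁ tight))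
              (realizes-restrict (not ∘ C) (λ s → proj₂ (∧-true⁻ s))
                (realizes-extremal 1≤h p rem S' rem-deg≤ rem-bounded (proj₂ tight) rem-isolated rem-edge))
              split C⊆S (λ s → proj₁ (∧-true⁻ s)) (λ c s → true≢false c (not-true (proj₂ (∧-true⁻ s))))
              (λ {u} {v} cu s → ¬-not λ a → true≢false (closed cu a) (not-true (proj₂ (∧-true⁻ s))))
    where
    rem : Graph
    rem = restrict G (not ∘ C)
    S' : Fin (n G) → Bool
    S' v = S v ∧ not (C v)
    rem-deg≤ : ∀ i → degree rem i ≤ Δ
    rem-deg≤ i = ≤-trans (degree-restrict-≤ G (not ∘ C) i) (deg≤ i)
    rem-bounded : Bounded rem (p * c)
    rem-bounded = subst (Bounded rem) (rest p ν ν≡) b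
    tight : edgeCount (restrict G C) ≡ Δ * c + h × edgeCount rem ≡ maxEdges (p * c)
    tight = +-tight (Component.inside-≤ G deg≤ C c count) (edgeCount-≤ (p * c) rem rem-deg≤ rem-bounded)
      (≤-reflexive (trans (exact p ν ν≡) (trans (sym edges) (edgeCount-partition G C closed))))
    rem-isolated : ∀ {v} → S' v ≡ false → degree rem v ≡ 0
    rem-isolated {v} s' = go (C v) refl
      where
      go : ∀ b → C v ≡ b → degree rem v ≡ 0
      go true  cv = degree-restrict-0 G (not ∘ C) (cong not cv)
      go false cv = n≤0⇒n≡0 (≤-trans (degree-restrict-≤ G (not ∘ C) v)
        (≤-reflexive (S-isolated (¬-not λ sv → true≢false (cong₂ (λ x y → x ∧ not y) sv cv) s'))))
    rem-edge : ∀ {v} → S' v ≡ true → 1 ≤ degree rem v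
    rem-edge {v} s' with ∧-true⁻ s'
    ... | sv , cv with degree-witness G (S-edge sv)
    ...   | j , vj = countF-pos (adj rem v) {j} (restrict⁺ G (not ∘ C) {v} {j} cv
      (cong not (¬-not λ cj → true≢false (closed cj (trans (adj-sym G j v) vj)) (not-true cv))) vj)
    C⊆S : ∀ {v} → C v ≡ true → S v ≡ true
    C⊆S {v} cv with C-edge cv
    ... | j , vj = ¬-not λ sv → contradiction (≤-trans (countF-pos (adj G v) vj) (≤-reflexive (S-isolated sv))) (λ ())
    split : ∀ {v} → S v ≡ true → C v ≡ true ⊎ S' v ≡ true
    split {v} sv with C v
    ... | true  = inj₁ refl
    ... | false = inj₂ (cong (_∧ true) sv)

-- Uniqueness if c divides ν or ν = 1

⌈n/2⌉≤1+⌊n/2⌋ : ∀ k → ⌈ k /2⌉ ≤ suc ⌊ k /2⌋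
⌈n/2⌉≤1+⌊n/2⌋ zero          = z≤n
⌈n/2⌉≤1+⌊n/2⌋ (suc zero)    = s≤s z≤n
⌈n/2⌉≤1+⌊n/2⌋ (suc (suc k)) = s≤s (⌈n/2⌉≤1+⌊n/2⌋ k)

matchingNumber⇒bounded : ∀ G {ν} → MatchingNumberIs G ν → Bounded G ν
matchingNumber⇒bounded G (_ , maximal) m M with matching⇒HasMatching G M
... | k , ck , H = ≤-trans (≤-reflexive ck) (+-mono-≤ (maximal k H) (maximal k H))

-- The predicate is `S v ≡ true` for the set `S = const true` of all vertices, the form in which the
-- realization lemmas give their results.
Determines : ℕ → ℕ → Shape → Set
Determines Δ ν s = ∀ G → Extremal Δ ν G → Realizes G (λ _ → true ≡ true) s

-- Without isolated vertices all degrees are 1, and h = 0 leaves ν edges.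
determines-pairs : ∀ ν → Determines 1 ν (pairs false ν)
determines-pairs ν G (noIsolated , (deg≤ , _) , _ , edges) = realizes-pairs ν (const true) vertices
  λ {v} _ → partner v (countF≡1 (adj G v) (degree≡1 v))
  where
  degree≡1 : ∀ v → degree G v ≡ 1
  degree≡1 v = ≤-antisym (deg≤ v) (noIsolated v)
  edges≡ν : edgeCount G ≡ ν
  edges≡ν = trans edges (trans (cong₂ _+_ (*-identityˡ ν) (*-zeroʳ (fdiv ν 1))) (+-identityʳ ν))
  vertices : countF {n G} (const true) ≡ ν + ν
  vertices = trans (sumF-cong (sym ∘ degree≡1)) (trans (handshake G) (cong₂ _+_ edges≡ν edges≡ν))
  partner : ∀ v → (∃ λ w → adj G v w ≡ true × (∀ {u} → adj G v u ≡ true → u ≡ w)) →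
    ∃ λ w → true ≡ true × w ≢ v × adj G v w ≡ true × (∀ {u} → true ≡ true → u ≢ v → u ≢ w → adj G v u ≡ false)
  partner v (w , vw , unique) = w , refl , adj⇒≢ G vw ∘ sym , vw , λ _ _ u≢w → ¬-not (u≢w ∘ unique)

-- For c ≥ 2 the floor term vanishes, so the Δ edges at a vertex of degree Δ are all the edges. As
-- no vertex is isolated, the others are its leaves.
determines-star : ∀ Δ → 2 ≤ ⌈ Δ /2⌉ → Determines Δ 1 (glue true dot (homogeneous false Δ))
determines-star Δ 2≤c G (noIsolated , (_ , v , deg-v) , _ , edges) = realizes-glue (realizes-dot v)
  (realizes-homogeneous Δ others (trans (sym (countF-cong v-others)) deg-v) λ ci cj _ → others-edgeless ci cj)
  split (λ _ → refl) (λ _ → refl) (λ { refl q → others≢ q refl }) (λ { {v = j} refl q → trans (v-others j) q })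
  where
  others : Fin (n G) → Bool
  others i = not (v ≈ᵇ i)
  others≢ : ∀ {i} → others i ≡ true → i ≢ v
  others≢ q refl = true≢false q (cong not (≈ᵇ-refl v))
  others⁺ : ∀ {i} → i ≢ v → others i ≡ true
  others⁺ i≢v = cong not (≈ᵇ-≢ (i≢v ∘ sym))
  rest-edges : edgeCount (delete G v) ≡ 0
  rest-edges = +-cancelʳ-≡ (degree G v) _ 0 (trans (sym (edgeCount-delete G v)) (trans edges
    (trans (cong₂ _+_ (*-identityʳ Δ) (cong (_* ⌊ Δ /2⌋) (fdiv-small 2≤c))) (trans (+-identityʳ Δ) (sym deg-v)))))
  delete-edgeless : ∀ i j → adj (delete G v) i j ≡ false
  delete-edgeless i = countF≡0 (adj (delete G v) i) (sumF≡0 (degree (delete G v))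
    (trans (handshake (delete G v)) (cong₂ _+_ rest-edges rest-edges)) i)
  others-edgeless : ∀ {i j} → others i ≡ true → others j ≡ true → adj G i j ≡ false
  others-edgeless {i} {j} ci cj = ¬-not λ a → true≢false (restrict⁺ G others {i} {j} ci cj a) (delete-edgeless i j)
  v-others : ∀ j → adj G v j ≡ others j
  v-others j with v ≟ j
  ... | yes refl = adj-irrefl G v
  ... | no v≢j with degree-witness G (noIsolated j)
  ...   | w , jw with w ≟ v
  ...     | yes refl = trans (adj-sym G v j) jw
  ...     | no w≢v   = ⊥-elim (true≢false jw (others-edgeless (others⁺ (v≢j ∘ sym)) (others⁺ w≢v)))
  split : ∀ {i} → true ≡ true → i ≡ v ⊎ others i ≡ true
  split {i} _ with i ≟ v
  ... | yes p = inj₁ p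
  ... | no p  = inj₂ (others⁺ p)

determines-copies : ∀ Δ q → 2 ≤ Δ → ∃ (Determines Δ (q * ⌈ Δ /2⌉))
determines-copies Δ q 2≤Δ = copies q block , λ G (noIsolated , (deg≤ , _) , number , edges) →
  realizes-extremal (⌊n/2⌋-mono 2≤Δ) q G (const true) deg≤ (matchingNumber⇒bounded G number) edges (λ ()) (λ {v} _ → noIsolated v)
  where open Extremality Δ ⌈ Δ /2⌉ ⌊ Δ /2⌋ (⌊n/2⌋+⌈n/2⌉≡n Δ) (⌊n/2⌋≤⌈n/2⌉ Δ) (⌈n/2⌉≤1+⌊n/2⌋ Δ) (⌈n/2⌉-mono (≤-trans (s≤s z≤n) 2≤Δ))

determined : ∀ Δ ν → 1 ≤ Δ → ⌈ Δ /2⌉ ∣ ν ⊎ ν ≡ 1 → ∃ (Determines Δ ν)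
determined 1 ν _ _ = pairs false ν , determines-pairs ν
determined Δ@(suc (suc _)) ν _ (inj₁ (divides q refl)) = determines-copies Δ q (s≤s (s≤s z≤n))
-- For Δ = 2 the ceiling is 1 and ν = 1 is a multiple of it; the single block is a triangle.
determined 2 .1 _ (inj₂ refl) = determines-copies 2 1 ≤-refl
determined Δ@(suc (suc (suc _))) .1 _ (inj₂ refl) =
  glue true dot (homogeneous false Δ) , determines-star Δ (s≤s (s≤s z≤n))

-- Graph constructions

empty : ℕ → Graph
empty m = record { n = m ; adj = λ _ _ → false ; sym = λ _ _ → refl ; irrefl = λ _ → refl }

extend : (G : Graph) → (Fin (n G) → Bool) → Graph
extend G P = record { n = suc (n G) ; adj = ext ; sym = ext-sym ; irrefl = ext-irrefl }
  where
  ext : Fin (suc (n G)) → Fin (suc (n G)) → Bool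
  ext zero    zero    = false
  ext zero    (suc j) = P j
  ext (suc i) zero    = P i
  ext (suc i) (suc j) = adj G i j
  ext-sym : ∀ i j → ext i j ≡ ext j i
  ext-sym zero    zero    = refl
  ext-sym zero    (suc j) = refl
  ext-sym (suc i) zero    = refl
  ext-sym (suc i) (suc j) = adj-sym G i j
  ext-irrefl : ∀ i → ext i i ≡ false
  ext-irrefl zero    = refl
  ext-irrefl (suc i) = adj-irrefl G i

star : ℕ → Graph
star m = extend (empty m) (const true)

union : Graph → Graph → Graph
union G H = record
  { n      = n G + n H
  ; adj    = λ i j → adj⊎ (splitAt (n G) i) (splitAt (n G) j)
  ; sym    = λ i j → sym⊎ (splitAt (n G) i) (splitAt (n G) j)
  ; irrefl = λ i → irrefl⊎ (splitAt (n G) i)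
  }
  where
  adj⊎ : Fin (n G) ⊎ Fin (n H) → Fin (n G) ⊎ Fin (n H) → Bool
  adj⊎ (inj₁ i) (inj₁ j) = adj G i j
  adj⊎ (inj₁ i) (inj₂ j) = false
  adj⊎ (inj₂ i) (inj₁ j) = false
  adj⊎ (inj₂ i) (inj₂ j) = adj H i j
  sym⊎ : ∀ x y → adj⊎ x y ≡ adj⊎ y x
  sym⊎ (inj₁ i) (inj₁ j) = adj-sym G i j
  sym⊎ (inj₁ i) (inj₂ j) = refl
  sym⊎ (inj₂ i) (inj₁ j) = refl
  sym⊎ (inj₂ i) (inj₂ j) = adj-sym H i j
  irrefl⊎ : ∀ x → adj⊎ x x ≡ false
  irrefl⊎ (inj₁ i) = adj-irrefl G i
  irrefl⊎ (inj₂ j) = adj-irrefl H j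

splitAt-elim : ∀ a {b} (P : Fin (a + b) → Set) → (∀ i → P (i ↑ˡ b)) → (∀ j → P (a ↑ʳ j)) → ∀ v → P v
splitAt-elim a {b} P left right v with splitAt a v | join-splitAt a b v
... | inj₁ i | e = subst P e (left i)
... | inj₂ j | e = subst P e (right j)

module _ (G H : Graph) where

  private
    a = n G
    b = n H
    U = union G H

  union-adjˡˡ : ∀ i j → adj U (i ↑ˡ b) (j ↑ˡ b) ≡ adj G i j
  union-adjˡˡ i j rewrite splitAt-↑ˡ a i b | splitAt-↑ˡ a j b = refl

  union-adjˡʳ : ∀ i j → adj U (i ↑ˡ b) (a ↑ʳ j) ≡ false
  union-adjˡʳ i j rewrite splitAt-↑ˡ a i b | splitAt-↑ʳ a b j = refl

  union-adjʳˡ : ∀ i j → adj U (a ↑ʳ i) (j ↑ˡ b) ≡ false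
  union-adjʳˡ i j rewrite splitAt-↑ʳ a b i | splitAt-↑ˡ a j b = refl

  union-adjʳʳ : ∀ i j → adj U (a ↑ʳ i) (a ↑ʳ j) ≡ adj H i j
  union-adjʳʳ i j rewrite splitAt-↑ʳ a b i | splitAt-↑ʳ a b j = refl

  union-degreeˡ : ∀ i → degree U (i ↑ˡ b) ≡ degree G i
  union-degreeˡ i = trans (sumF-↑ a b _) (trans (cong₂ _+_
    (sumF-cong (λ j → cong ind (union-adjˡˡ i j)))
    (trans (sumF-cong (λ j → cong ind (union-adjˡʳ i j))) (sumF-0 b))) (+-identityʳ _))

  union-degreeʳ : ∀ j → degree U (a ↑ʳ j) ≡ degree H j
  union-degreeʳ i = trans (sumF-↑ a b _) (cong₂ _+_
    (trans (sumF-cong (λ j → cong ind (union-adjʳˡ i j))) (sumF-0 a))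
    (sumF-cong (λ j → cong ind (union-adjʳʳ i j))))

  union-degreeSum : degreeSum U ≡ degreeSum G + degreeSum H
  union-degreeSum = trans (sumF-↑ a b (degree U)) (cong₂ _+_ (sumF-cong union-degreeˡ) (sumF-cong union-degreeʳ))

  union-all : ∀ (Q : ℕ → Set) → (∀ i → Q (degree G i)) → (∀ j → Q (degree H j)) → ∀ v → Q (degree U v)
  union-all Q p q = splitAt-elim a (Q ∘ degree U)
    (λ i → subst Q (sym (union-degreeˡ i)) (p i)) (λ j → subst Q (sym (union-degreeʳ j)) (q j))

  union-bounded : ∀ k l → Bounded G k → Bounded H l → Bounded U (k + l)
  union-bounded k l bG bH m M@(inv , e) = begin
    cov m                  ≡⟨ sumF-↑ a b (ind ∘ moved m) ⟩
    sumF (λ i → ind (moved m (i ↑ˡ b))) + sumF (λ j → ind (moved m (a ↑ʳ j)))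
      ≡⟨ cong₂ _+_ (sumF-cong λ i → cong ind (moved-cong {m = m} {mˡ} {i ↑ˡ b} {i} (λ p → ↑ˡ-injective b _ _ (trans (sym (mˡ-eq i)) p)) (λ p → trans (mˡ-eq i) (cong (_↑ˡ b) p))))
                   (sumF-cong λ j → cong ind (moved-cong {m = m} {mʳ} {a ↑ʳ j} {j} (λ p → ↑ʳ-injective a _ _ (trans (sym (mʳ-eq j)) p)) (λ p → trans (mʳ-eq j) (cong (a ↑ʳ_) p)))) ⟩
    cov mˡ + cov mʳ        ≤⟨ +-mono-≤ (bG mˡ (invˡ , edgeˡ)) (bH mʳ (invʳ , edgeʳ)) ⟩
    k + k + (l + l)        ≡⟨ interchange k k l l ⟩
    k + l + (k + l)        ∎
    where
    open ≤-Reasoning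
    left : ∀ i → ∃ λ j → m (i ↑ˡ b) ≡ j ↑ˡ b
    left i with e (i ↑ˡ b)
    ... | inj₁ p = i , p
    ... | inj₂ p = splitAt-elim a (λ w → adj U (i ↑ˡ b) w ≡ true → ∃ λ j → w ≡ j ↑ˡ b)
      (λ j _ → j , refl) (λ j q → ⊥-elim (true≢false q (union-adjˡʳ i j))) (m (i ↑ˡ b)) p
    right : ∀ i → ∃ λ j → m (a ↑ʳ i) ≡ a ↑ʳ j
    right i with e (a ↑ʳ i)
    ... | inj₁ p = i , p
    ... | inj₂ p = splitAt-elim a (λ w → adj U (a ↑ʳ i) w ≡ true → ∃ λ j → w ≡ a ↑ʳ j)
      (λ j q → ⊥-elim (true≢false q (union-adjʳˡ i j))) (λ j _ → j , refl) (m (a ↑ʳ i)) p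
    mˡ : Fin a → Fin a
    mˡ i = proj₁ (left i)
    mʳ : Fin b → Fin b
    mʳ j = proj₁ (right j)
    mˡ-eq : ∀ i → m (i ↑ˡ b) ≡ mˡ i ↑ˡ b
    mˡ-eq i = proj₂ (left i)
    mʳ-eq : ∀ j → m (a ↑ʳ j) ≡ a ↑ʳ mʳ j
    mʳ-eq j = proj₂ (right j)
    invˡ : ∀ i → mˡ (mˡ i) ≡ i
    invˡ i = ↑ˡ-injective b _ _ (trans (sym (mˡ-eq (mˡ i))) (trans (cong m (sym (mˡ-eq i))) (inv _)))
    invʳ : ∀ j → mʳ (mʳ j) ≡ j
    invʳ j = ↑ʳ-injective a _ _ (trans (sym (mʳ-eq (mʳ j))) (trans (cong m (sym (mʳ-eq j))) (inv _)))
    edgeˡ : ∀ i → mˡ i ≡ i ⊎ adj G i (mˡ i) ≡ true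
    edgeˡ i = [ (λ p → inj₁ (↑ˡ-injective b _ _ (trans (sym (mˡ-eq i)) p))) , (λ p → inj₂ (trans (sym (union-adjˡˡ i (mˡ i))) (trans (cong (adj U (i ↑ˡ b)) (sym (mˡ-eq i))) p))) ]′ (e (i ↑ˡ b))
    edgeʳ : ∀ j → mʳ j ≡ j ⊎ adj H j (mʳ j) ≡ true
    edgeʳ j = [ (λ p → inj₁ (↑ʳ-injective a _ _ (trans (sym (mʳ-eq j)) p))) , (λ p → inj₂ (trans (sym (union-adjʳʳ j (mʳ j))) (trans (cong (adj U (a ↑ʳ j)) (sym (mʳ-eq j))) p))) ]′ (e (a ↑ʳ j))

empty-bounded : ∀ m → Bounded (empty m) 0
empty-bounded m f (_ , e) = ≤-reflexive (countF-none (moved f) λ v → moved-fix {m = f} (fixed v))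
  where
  fixed : ∀ v → f v ≡ v
  fixed v with e v
  ... | inj₁ p = p

-- Freeing the new vertex costs at most one edge of the matching and leaves a matching of `G`.
extend-bounded : ∀ G P k → Bounded G k → Bounded (extend G P) (suc k)
extend-bounded G P k bounded m M = ≤-trans reduce (≤-reflexive (cong suc (sym (+-suc k k))))
  where
  V = Fin (suc (n G))
  fixing : ∀ m → IsMatching (extend G P) m → m zero ≡ zero → cov m ≤ k + k
  fixing m (inv , e) m0 = ≤-trans (≤-reflexive (cong₂ (λ x y → ind x + y) (moved-fix {m = m} m0)
    (countF-cong λ i → moved-cong {m = m} {m'} {suc i} {i} (λ p → Data.Fin.Properties.suc-injective (trans (sym (m'-eq i)) p)) (λ p → trans (m'-eq i) (cong suc p)))))
    (bounded m' ((λ i → Data.Fin.Properties.suc-injective (trans (sym (m'-eq (m' i))) (trans (cong m (sym (m'-eq i))) (inv (suc i))))) , e'))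
    where
    tail : ∀ i → ∃ λ j → m (suc i) ≡ suc j
    tail i with m (suc i) in eq
    ... | suc j = j , refl
    ... | zero with trans (sym (inv (suc i))) (trans (cong m eq) m0)
    ...   | ()
    m' : Fin (n G) → Fin (n G)
    m' i = proj₁ (tail i)
    m'-eq : ∀ i → m (suc i) ≡ suc (m' i)
    m'-eq i = proj₂ (tail i)
    e' : ∀ i → m' i ≡ i ⊎ adj G i (m' i) ≡ true
    e' i = [ (λ p → inj₁ (Data.Fin.Properties.suc-injective (trans (sym (m'-eq i)) p)))
           , (λ p → inj₂ (trans (cong (adj (extend G P) (suc i)) (sym (m'-eq i))) p)) ]′ (e (suc i))
  reduce : cov m ≤ suc (suc (k + k))
  reduce = by-cases (m zero ≟ zero)
    where
    by-cases : Dec (m zero ≡ zero) → cov m ≤ suc (suc (k + k))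
    by-cases (yes p) = ≤-trans (fixing m M p) (≤-trans (n≤1+n _) (n≤1+n _))
    by-cases (no p)  = ≤-trans (≤-reflexive (cov-unmatch (extend G P) M p))
      (s≤s (s≤s (fixing (unmatch m zero) (unmatch-isMatching (extend G P) M zero) (unmatch-fst m zero))))

extend-degreeSum : ∀ G P → degreeSum (extend G P) ≡ countF P + countF P + degreeSum G
extend-degreeSum G P = trans (cong (countF P +_) (sumF-+ (ind ∘ P) (degree G))) (sym (+-assoc (countF P) _ _))

order-bounded : ∀ G k → n G ≤ suc (k + k) → Bounded G k
order-bounded G k order m M with matching⇒HasMatching G M
... | j , cj , _ = ≤-trans (≤-reflexive cj) (+-mono-≤ j≤k j≤k)
  where
  j≤k : j ≤ k
  j≤k = halve (≤-trans (≤-reflexive (sym cj)) (≤-trans (countF-≤ (moved m)) order))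

complement-degree′ : ∀ G i → degree G i + degree (complement G) i + 1 ≡ n G
complement-degree′ G i = trans (complement-degree G (const true) {i} refl) (countF-true (n G))

complement-degreeSum′ : ∀ G → degreeSum G + degreeSum (complement G) + n G ≡ n G * n G
complement-degreeSum′ G = subst (λ z → degreeSum G + degreeSum (complement G) + z ≡ z * z) (countF-true (n G))
  (complement-degreeSum G (const true))

-- Ends in `H` and not in the empty graph, so that a vertex of maximum degree exists even when the
-- number of copies is 0.
copiesOnto : ℕ → Graph → Graph → Graph
copiesOnto zero    G H = H
copiesOnto (suc q) G H = union G (copiesOnto q G H)

copiesOnto-order : ∀ q G H → n (copiesOnto q G H) ≡ q * n G + n H
copiesOnto-order zero    G H = refl
copiesOnto-order (suc q) G H = trans (cong (n G +_) (copiesOnto-order q G H)) (sym (+-assoc (n G) _ _))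

copiesOnto-all : ∀ q G H (Q : ℕ → Set) → (∀ i → Q (degree G i)) → (∀ j → Q (degree H j)) →
  ∀ v → Q (degree (copiesOnto q G H) v)
copiesOnto-all zero    G H Q p r = r
copiesOnto-all (suc q) G H Q p r = union-all G (copiesOnto q G H) Q p (copiesOnto-all q G H Q p r)

copiesOnto-degreeSum : ∀ q G H → degreeSum (copiesOnto q G H) ≡ q * degreeSum G + degreeSum H
copiesOnto-degreeSum zero    G H = refl
copiesOnto-degreeSum (suc q) G H = trans (union-degreeSum G (copiesOnto q G H))
  (trans (cong (degreeSum G +_) (copiesOnto-degreeSum q G H)) (sym (+-assoc (degreeSum G) _ _)))

copiesOnto-vertex : ∀ q G H (w : Fin (n H)) → ∃ λ v → degree (copiesOnto q G H) v ≡ degree H w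
copiesOnto-vertex zero    G H w = w , refl
copiesOnto-vertex (suc q) G H w with copiesOnto-vertex q G H w
... | v , e = n G ↑ʳ v , trans (union-degreeʳ G (copiesOnto q G H) v) e

-- Both the upper bound `k` for matchings and the edge number `e` add up over disjoint unions. That
-- `k` is attained is not recorded for the pieces; it follows for the finished graph from the edge
-- bound.
record IsBlock (Δ k e : ℕ) (G : Graph) : Set where
  field
    noIsolated : NoIsolated G
    degrees    : MaxDegreeIs G Δ
    bounded    : Bounded G k
    degreeSum≡ : degreeSum G ≡ e + e

open IsBlock

union-isBlock : ∀ {Δ k l e f} G H → IsBlock Δ k e G → IsBlock Δ l f H → IsBlock Δ (k + l) (e + f) (union G H)
union-isBlock {Δ} {k} {l} {e} {f} G H B C = record
  { noIsolated = union-all G H (1 ≤_) (noIsolated B) (noIsolated C)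
  ; degrees    = union-all G H (_≤ Δ) (proj₁ (degrees B)) (proj₁ (degrees C)) ,
                 (let v , p = proj₂ (degrees C) in n G ↑ʳ v , trans (union-degreeʳ G H v) p)
  ; bounded    = union-bounded G H k l (bounded B) (bounded C)
  ; degreeSum≡ = trans (union-degreeSum G H) (trans (cong₂ _+_ (degreeSum≡ B) (degreeSum≡ C)) (interchange e e f f))
  }

copiesOnto-isBlock : ∀ {Δ k l e f} q G H → IsBlock Δ k e G → IsBlock Δ l f H →
  IsBlock Δ (q * k + l) (q * e + f) (copiesOnto q G H)
copiesOnto-isBlock zero G H B C = C
copiesOnto-isBlock {Δ} {k} {l} {e} {f} (suc q) G H B C =
  subst (λ x → IsBlock Δ x (e + q * e + f) (union G (copiesOnto q G H))) (sym (+-assoc k (q * k) l))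
    (subst (λ x → IsBlock Δ (k + (q * k + l)) x (union G (copiesOnto q G H))) (sym (+-assoc e (q * e) f))
      (union-isBlock G (copiesOnto q G H) B (copiesOnto-isBlock q G H B C)))

star-isBlock : ∀ {Δ} → 1 ≤ Δ → IsBlock Δ 1 Δ (star Δ)
star-isBlock {Δ} 1≤Δ = record
  { noIsolated = λ { zero → ≤-trans 1≤Δ (≤-reflexive (sym centre)) ; (suc i) → s≤s z≤n }
  ; degrees    = (λ { zero → ≤-reflexive centre ; (suc i) → ≤-trans (≤-reflexive (leaf i)) 1≤Δ }) , zero , centre
  ; bounded    = extend-bounded (empty Δ) (const true) 0 (empty-bounded Δ)
  ; degreeSum≡ = trans (extend-degreeSum (empty Δ) (const true)) (trans (cong₂ _+_ (cong₂ _+_ centre centre)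
                   (trans (sumF-cong {Δ} (λ _ → sumF-0 Δ)) (sumF-0 Δ))) (+-identityʳ _))
  }
  where
  centre : degree (star Δ) zero ≡ Δ
  centre = countF-true Δ
  leaf : ∀ i → degree (star Δ) (suc i) ≡ 1
  leaf i = cong suc (sumF-0 Δ)

-- K_{2,Δ}; it has the edges and the matching number of two disjoint stars.
doubleStar : ℕ → Graph
doubleStar Δ = extend (star Δ) leaves
  where
  leaves : Fin (suc Δ) → Bool
  leaves zero    = false
  leaves (suc _) = true

doubleStar-isBlock : ∀ {Δ} → 2 ≤ Δ → IsBlock Δ 2 (Δ + Δ) (doubleStar Δ)
doubleStar-isBlock {Δ} 2≤Δ = record
  { noIsolated = λ { zero → ≤-trans 1≤Δ (≤-reflexive (sym (countF-true Δ))) ; (suc zero) → noIsolated S zero ; (suc (suc i)) → s≤s z≤n }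
  ; degrees    = (λ { zero → ≤-reflexive (countF-true Δ) ; (suc zero) → proj₁ (degrees S) zero
                    ; (suc (suc i)) → ≤-trans (≤-reflexive (cong (2 +_) (sumF-0 Δ))) 2≤Δ }) , zero , countF-true Δ
  ; bounded    = extend-bounded (star Δ) (adj (doubleStar Δ) zero ∘ suc) 1 (bounded S)
  ; degreeSum≡ = trans (extend-degreeSum (star Δ) (adj (doubleStar Δ) zero ∘ suc)) (cong₂ _+_ (cong₂ _+_ (countF-true Δ) (countF-true Δ)) (degreeSum≡ S))
  }
  where
  1≤Δ = ≤-trans (s≤s z≤n) 2≤Δ
  S = star-isBlock 1≤Δ

-- On 2k + 1 vertices a degree d turns into 2k - d, and the order alone bounds matchings by k. The
-- hypotheses are the block conditions rewritten for `X` without subtraction.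
complement-isBlock : ∀ {Δ k e} X → n X ≡ suc (k + k) → (∀ i → degree X i < k + k) →
  (∀ i → k + k ≤ Δ + degree X i) → (∃ λ i → k + k ≡ Δ + degree X i) →
  e + e + degreeSum X ≡ (k + k) * n X → IsBlock Δ k e (complement X)
complement-isBlock {Δ} {k} {e} X order small large (w , full) total = record
  { noIsolated = λ i → +-cancelˡ-≤ (degree X i) 1 _ (≤-trans (≤-reflexive (+-comm _ 1)) (≤-trans (small i) (≤-reflexive (sym (sum i)))))
  ; degrees    = (λ i → +-cancelʳ-≤ (degree X i) _ Δ (≤-trans (≤-reflexive (trans (+-comm _ (degree X i)) (sum i))) (large i))) ,
                 w , +-cancelʳ-≡ (degree X w) _ Δ (trans (+-comm _ (degree X w)) (trans (sum w) full))
  ; bounded    = order-bounded (complement X) k (≤-reflexive order)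
  ; degreeSum≡ = +-cancelˡ-≡ (degreeSum X) _ _ (+-cancelʳ-≡ (n X) _ _ (trans (complement-degreeSum′ X)
      (trans (cong (_* n X) (trans order (+-comm 1 (k + k)))) (trans (*-distribʳ-+ (n X) (k + k) 1)
        (cong₂ _+_ (trans (sym total) (+-comm (e + e) (degreeSum X))) (*-identityˡ (n X)))))))
  }
  where
  sum : ∀ i → degree X i + degree (complement X) i ≡ k + k
  sum i = suc-injective (trans (+-comm 1 _) (trans (complement-degree′ X i) order))

K₂ C₄ : Graph
K₂ = star 1
C₄ = complement (union K₂ K₂)

K₂-regular : ∀ i → degree K₂ i ≡ 1
K₂-regular zero       = refl
K₂-regular (suc zero) = refl

C₄-regular : ∀ i → degree C₄ i ≡ 2
C₄-regular zero                   = refl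
C₄-regular (suc zero)             = refl
C₄-regular (suc (suc zero))       = refl
C₄-regular (suc (suc (suc zero))) = refl

K₃ : Graph
K₃ = complement (empty 3)

K₃-regular : ∀ i → degree K₃ i ≡ 2
K₃-regular zero             = refl
K₃-regular (suc zero)       = refl
K₃-regular (suc (suc zero)) = refl

complete-isBlock : ∀ {c} → 1 ≤ c → IsBlock (c + c) c ((c + c) * c + c) (complement (empty (suc (c + c))))
complete-isBlock {c} 1≤c = complement-isBlock (empty (suc (c + c))) refl
  (λ i → ≤-trans (s≤s (≤-reflexive (none i))) (≤-trans 1≤c (m≤m+n c c)))
  (λ i → m≤m+n (c + c) _) (zero , trans (sym (+-identityʳ _)) (cong (c + c +_) (sym (none zero))))
  (trans (cong ((c + c) * c + c + ((c + c) * c + c) +_) (trans (sumF-cong none) (sumF-0 (suc (c + c))))) (arith c))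
  where
  none : ∀ (i : Fin (suc (c + c))) → degree (empty (suc (c + c))) i ≡ 0
  none i = sumF-0 (suc (c + c))
  arith : ∀ c → (c + c) * c + c + ((c + c) * c + c) + 0 ≡ (c + c) * suc (c + c)
  arith = solve-∀

-- `star 2` is the path on three vertices. In the complement its ends have degree Δ = 2h + 1 and its
-- middle has degree Δ - 1.
pathAndPairs : ℕ → Graph
pathAndPairs h = copiesOnto h K₂ (star 2)

module PathAndPairs (h : ℕ) where

  order : n (pathAndPairs h) ≡ suc (suc h + suc h)
  order = trans (copiesOnto-order h K₂ (star 2)) (arith h)
    where
    arith : ∀ h → h * 2 + 3 ≡ suc (suc h + suc h)
    arith = solve-∀

  degree≥1 : ∀ i → 1 ≤ degree (pathAndPairs h) i
  degree≥1 = copiesOnto-all h K₂ (star 2) (1 ≤_) (λ i → ≤-reflexive (sym (K₂-regular i)))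
    λ { zero → s≤s z≤n ; (suc zero) → s≤s z≤n ; (suc (suc zero)) → s≤s z≤n }

  degree≤2 : ∀ i → degree (pathAndPairs h) i ≤ 2
  degree≤2 = copiesOnto-all h K₂ (star 2) (_≤ 2) (λ i → ≤-trans (≤-reflexive (K₂-regular i)) (n≤1+n 1))
    λ { zero → ≤-refl ; (suc zero) → s≤s z≤n ; (suc (suc zero)) → s≤s z≤n }

  endpoint : ∃ λ i → degree (pathAndPairs h) i ≡ 1
  endpoint = copiesOnto-vertex h K₂ (star 2) (suc zero)

  midpoint : ∃ λ i → degree (pathAndPairs h) i ≡ 2
  midpoint = copiesOnto-vertex h K₂ (star 2) zero

  total : degreeSum (pathAndPairs h) ≡ h * 2 + 4
  total = copiesOnto-degreeSum h K₂ (star 2)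

nearComplete : ℕ → Graph
nearComplete h = complement (pathAndPairs h)

nearComplete-isBlock : ∀ {h} → 1 ≤ h → IsBlock (h + suc h) (suc h) ((h + suc h) * suc h + h) (nearComplete h)
nearComplete-isBlock {h} 1≤h = complement-isBlock (pathAndPairs h) order
  (λ i → ≤-trans (s≤s (degree≤2 i)) (≤-trans (+-mono-≤ (s≤s 1≤h) 1≤h) (+-monoʳ-≤ (suc h) (n≤1+n h))))
  (λ i → ≤-trans (≤-reflexive (+-comm 1 _)) (+-monoʳ-≤ (h + suc h) (degree≥1 i)))
  (proj₁ endpoint , trans (+-comm 1 _) (cong (h + suc h +_) (sym (proj₂ endpoint))))
  (trans (cong ((h + suc h) * suc h + h + ((h + suc h) * suc h + h) +_) total)
    (trans (arith h) (cong ((suc h + suc h) *_) (sym order))))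
  where
  open PathAndPairs h
  arith : ∀ h → (h + suc h) * suc h + h + ((h + suc h) * suc h + h) + (h * 2 + 4) ≡ (suc h + suc h) * suc (suc h + suc h)
  arith = solve-∀

-- With Δ = 2h + 1 this vertex, the middle of the path, has room for one more edge.
nearComplete-deficient : ∀ h → ∃ λ a → degree (nearComplete h) a ≡ h + h
nearComplete-deficient h with PathAndPairs.midpoint h
... | a , da = a , suc-injective (suc-injective (suc-injective (trans (arith (degree (nearComplete h) a))
    (trans (cong (λ d → d + degree (nearComplete h) a + 1) (sym da)) (trans (complement-degree′ (pathAndPairs h) a)
      (trans (PathAndPairs.order h) (cong (λ z → suc (suc z)) (+-suc h h))))))))
  where
  arith : ∀ d → suc (suc (suc d)) ≡ 2 + d + 1
  arith = solve-∀

-- For odd Δ the star gets one of its leaves identified with the vertex of degree Δ − 1.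
shared : ℕ → Graph
shared h = extend (union (nearComplete h) (empty (h + h)))
  (λ v → [ (proj₁ (nearComplete-deficient h) ≈ᵇ_) , const true ]′ (splitAt (n (nearComplete h)) v))

-- The new centre has 1 + 2h = Δ neighbours and raises the matching bound by one, just as a separate
-- star would, but with one vertex fewer.
shared-isBlock : ∀ {h} → 1 ≤ h →
  IsBlock (h + suc h) (suc h + 1) ((h + suc h) * suc h + h + (h + suc h)) (shared h)
shared-isBlock {h} 1≤h = record
  { noIsolated = λ { zero → ≤-trans (s≤s z≤n) (≤-reflexive (sym centre))
                   ; (suc v) → splitAt-elim a (λ v → 1 ≤ degree (shared h) (suc v))
                       (λ i → subst (1 ≤_) (sym (degreeˡ i)) (≤-trans (noIsolated N i) (m≤n+m _ _)))
                       (λ j → subst (1 ≤_) (sym (degreeʳ j)) ≤-refl) v }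
  ; degrees    = (λ { zero → ≤-reflexive (trans centre (sym (+-suc h h)))
                    ; (suc v) → splitAt-elim a (λ v → degree (shared h) (suc v) ≤ h + suc h)
                       (λ i → subst (_≤ h + suc h) (sym (degreeˡ i)) (touched i))
                       (λ j → subst (_≤ h + suc h) (sym (degreeʳ j)) (≤-trans (s≤s z≤n) (m≤n+m (suc h) h))) v }) ,
                 zero , trans centre (sym (+-suc h h))
  ; bounded    = subst (Bounded (shared h)) (trans (cong suc (+-identityʳ (suc h))) (+-comm 1 (suc h)))
                   (extend-bounded U P (suc h + 0) (union-bounded (nearComplete h) (empty (h + h)) (suc h) 0 (bounded N) (empty-bounded (h + h))))
  ; degreeSum≡ = trans (extend-degreeSum U P) (trans (cong₂ _+_ (cong₂ _+_ centre centre)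
      (trans (union-degreeSum (nearComplete h) (empty (h + h))) (cong₂ _+_ (degreeSum≡ N)
        (trans (sumF-cong {h + h} (λ _ → sumF-0 (h + h))) (sumF-0 (h + h)))))) (arith h))
  }
  where
  a = n (nearComplete h)
  s = proj₁ (nearComplete-deficient h)
  N = nearComplete-isBlock 1≤h
  U = union (nearComplete h) (empty (h + h))
  P : Fin (n U) → Bool
  P v = [ (s ≈ᵇ_) , const true ]′ (splitAt a v)
  Pˡ : ∀ i → P (i ↑ˡ (h + h)) ≡ s ≈ᵇ i
  Pˡ i rewrite splitAt-↑ˡ a i (h + h) = refl
  Pʳ : ∀ j → P (a ↑ʳ j) ≡ true
  Pʳ j rewrite splitAt-↑ʳ a (h + h) j = refl
  centre : countF P ≡ suc (h + h)
  centre = trans (sumF-↑ a (h + h) (ind ∘ P)) (cong₂ _+_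
    (trans (sumF-cong (λ i → cong ind (Pˡ i))) (countF-≈ᵇ s))
    (trans (sumF-cong (λ j → cong ind (Pʳ j))) (countF-true (h + h))))
  degreeˡ : ∀ i → degree (shared h) (suc (i ↑ˡ (h + h))) ≡ ind (s ≈ᵇ i) + degree (nearComplete h) i
  degreeˡ i = cong₂ _+_ (cong ind (Pˡ i)) (union-degreeˡ (nearComplete h) (empty (h + h)) i)
  degreeʳ : ∀ j → degree (shared h) (suc (a ↑ʳ j)) ≡ 1
  degreeʳ j = cong₂ _+_ (cong ind (Pʳ j)) (trans (union-degreeʳ (nearComplete h) (empty (h + h)) j) (sumF-0 (h + h)))
  touched : ∀ i → ind (s ≈ᵇ i) + degree (nearComplete h) i ≤ h + suc h
  touched i = by-cases (s ≟ i)
    where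
    by-cases : Dec (s ≡ i) → ind (s ≈ᵇ i) + degree (nearComplete h) i ≤ h + suc h
    by-cases (yes p) = ≤-trans (≤-reflexive (cong₂ _+_ (cong ind (dec-true (s ≟ i) p))
      (trans (cong (degree (nearComplete h)) (sym p)) (proj₂ (nearComplete-deficient h))))) (≤-reflexive (sym (+-suc h h)))
    by-cases (no p)  = ≤-trans (≤-reflexive (cong (λ b → ind b + degree (nearComplete h) i) (≈ᵇ-≢ p))) (proj₁ (degrees N) i)
  arith : ∀ h → suc (h + h) + suc (h + h) + ((h + suc h) * suc h + h + ((h + suc h) * suc h + h) + 0) ≡
    (h + suc h) * suc h + h + (h + suc h) + ((h + suc h) * suc h + h + (h + suc h))
  arith = solve-∀

-- Every odd number from 7 on is a sum of threes and fours.
cycles : ℕ → Graph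
cycles zero          = union K₃ C₄
cycles (suc zero)    = union K₃ (union K₃ K₃)
cycles (suc (suc m)) = union C₄ (cycles m)

cycles-regular : ∀ m i → degree (cycles m) i ≡ 2
cycles-regular zero          = union-all K₃ C₄ (_≡ 2) K₃-regular C₄-regular
cycles-regular (suc zero)    = union-all K₃ (union K₃ K₃) (_≡ 2) K₃-regular (union-all K₃ K₃ (_≡ 2) K₃-regular K₃-regular)
cycles-regular (suc (suc m)) = union-all C₄ (cycles m) (_≡ 2) C₄-regular (cycles-regular m)

cycles-order : ∀ m → n (cycles m) ≡ 7 + (m + m)
cycles-order zero          = refl
cycles-order (suc zero)    = refl
cycles-order (suc (suc m)) = trans (cong (4 +_) (cycles-order m)) (arith m)
  where
  arith : ∀ m → 4 + (7 + (m + m)) ≡ 7 + (suc (suc m) + suc (suc m))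
  arith = solve-∀

cycles-vertex : ∀ m → Fin (n (cycles m))
cycles-vertex m = subst Fin (sym (cycles-order m)) zero

-- For Δ = 2c the order 7 + 2m is Δ + 3 = 2(c + 1) + 1. The complement of a 2-regular graph of this
-- order is Δ-regular and has c(2c + 3) = (Δc + c) + Δ edges, those of a complete block and a star.
coCycles-isBlock : ∀ m → let c = suc (suc m) in
  IsBlock (c + c) (c + 1) ((c + c) * c + c + (c + c)) (complement (cycles m))
coCycles-isBlock m = complement-isBlock (cycles m) (trans (cycles-order m) (arith₁ m))
  (λ i → ≤-trans (s≤s (≤-reflexive (cycles-regular m i))) (≤-trans (m≤m+n 3 (m + m + 3)) (≤-reflexive (arith₂ m))))
  (λ i → ≤-reflexive (sum i)) (cycles-vertex m , sum (cycles-vertex m))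
  (trans (cong (e + e +_) (trans (sumF-cong (cycles-regular m)) (sumF-const (n (cycles m)) 2)))
    (trans (cong (λ z → e + e + z * 2) (cycles-order m)) (trans (arith₃ m) (cong ((k + k) *_) (sym (cycles-order m))))))
  where
  c = suc (suc m)
  k = c + 1
  e = (c + c) * c + c + (c + c)
  arith₁ : ∀ m → 7 + (m + m) ≡ suc (suc (suc m) + 1 + (suc (suc m) + 1))
  arith₁ = solve-∀
  arith₂ : ∀ m → 3 + (m + m + 3) ≡ suc (suc m) + 1 + (suc (suc m) + 1)
  arith₂ = solve-∀
  sum : ∀ i → k + k ≡ c + c + degree (cycles m) i
  sum i = trans (arith₄ m) (cong (c + c +_) (sym (cycles-regular m i)))
    where
    arith₄ : ∀ m → suc (suc m) + 1 + (suc (suc m) + 1) ≡ suc (suc m) + suc (suc m) + 2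
    arith₄ = solve-∀
  arith₃ : ∀ m → (suc (suc m) + suc (suc m)) * suc (suc m) + suc (suc m) + (suc (suc m) + suc (suc m)) +
    ((suc (suc m) + suc (suc m)) * suc (suc m) + suc (suc m) + (suc (suc m) + suc (suc m))) + (7 + (m + m)) * 2 ≡
    (suc (suc m) + 1 + (suc (suc m) + 1)) * (7 + (m + m))
  arith₃ = solve-∀

-- Two extremal graphs of different orders

module Existence (Δ c h : ℕ) (Δ≡ : h + c ≡ Δ) (h≤c : h ≤ c) (c≤1+h : c ≤ suc h) (1≤c : 1 ≤ c) where

  open Bound Δ c h Δ≡ h≤c c≤1+h 1≤c

  -- A smaller matching number would contradict the Chvátal–Hanson bound.
  matchingNumber : ∀ {ν G} → 1 ≤ Δ → 1 ≤ ν → IsBlock Δ ν (maxEdges ν) G → edgeCount G ≡ maxEdges ν × MatchingNumberIs G ν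
  matchingNumber {suc ν} {G} 1≤Δ _ B = edges , attained , maximal
    where
    edges : edgeCount G ≡ maxEdges (suc ν)
    edges = double-injective (trans (sym (handshake G)) (degreeSum≡ B))
    maximal : ∀ k → HasMatching G k → k ≤ suc ν
    maximal k H with HasMatching⇒matching G k H
    ... | m , M , cm = double-cancel-≤ (≤-trans (≤-reflexive (sym cm)) (bounded B m M))
    attained : HasMatching G (suc ν)
    attained with search (Large G (suc ν)) (Large-resp G (suc ν)) (Large? G (suc ν))
    ... | no none = contradiction (<-≤-trans (m<m+n (maxEdges ν) 1≤Δ) (≤-trans (maxEdges-suc ν) (≤-trans (≤-reflexive (sym edges))
      (edgeCount-≤ ν G (proj₁ (degrees B)) (λ m M → cov-parity G M λ l → none (m , M , l)))))) 1+n≰n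
    ... | yes (m , M , l) with matching⇒HasMatching G M
    ...   | k , ck , H = subst (HasMatching G)
      (≤-antisym (maximal k H) (double-cancel-≤ (≤-trans l (≤-reflexive ck)))) H

  Alternatives : ℕ → Set
  Alternatives ν = ∃₂ λ G H → IsBlock Δ ν (maxEdges ν) G × IsBlock Δ ν (maxEdges ν) H × n G ≢ n H

  maxEdges-+ : ∀ q r → r < c → maxEdges (q * c + r) ≡ q * (Δ * c + h) + r * Δ
  maxEdges-+ q r r<c = trans (cong (λ z → Δ * (q * c + r) + z * h) (floor q)) (arith Δ q c r h)
    where
    floor : ∀ q → fdiv (q * c + r) c ≡ q
    floor zero    = fdiv-small r<c
    floor (suc q) = trans (fdiv-∸ 1≤c (≤-trans (m≤m+n c (q * c)) (m≤m+n (c + q * c) r)))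
      (cong suc (trans (cong (λ z → fdiv z c) (trans (cong (_∸ c) (+-assoc c (q * c) r)) (m+n∸m≡n c (q * c + r)))) (floor q)))
    arith : ∀ d q c r h → d * (q * c + r) + q * h ≡ q * (d * c + h) + r * d
    arith = solve-∀

  module _ (D : Graph) (D-block : IsBlock Δ c (Δ * c + h) D) where

    -- Two units of the remainder are realized by two stars or by K_{2,Δ}: 2Δ edges and matching
    -- bound 2 in both cases, but 2Δ + 2 against Δ + 2 vertices.
    many-stars : ∀ q r → suc (suc r) < c → 2 ≤ Δ → Alternatives (q * c + suc (suc r))
    many-stars q r r<c 2≤Δ = build (union (star Δ) (star Δ)) , build (doubleStar Δ) ,
      build-block (union-isBlock (star Δ) (star Δ) S S) , build-block (doubleStar-isBlock 2≤Δ) , λ e →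
        order≢ (+-cancelˡ-≡ (r * suc Δ) _ _ (trans (sym (copiesOnto-order r (star Δ) _)) (trans
          (+-cancelˡ-≡ (q * n D) _ _ (trans (sym (copiesOnto-order q D _)) (trans e (copiesOnto-order q D _))))
          (copiesOnto-order r (star Δ) _))))
      where
      S = star-isBlock (≤-trans (s≤s z≤n) 2≤Δ)
      build : Graph → Graph
      build G = copiesOnto q D (copiesOnto r (star Δ) G)
      build-block : ∀ {G} → IsBlock Δ 2 (Δ + Δ) G → IsBlock Δ (q * c + suc (suc r)) (maxEdges (q * c + suc (suc r))) (build G)
      build-block {G} B = subst (λ e → IsBlock Δ (q * c + suc (suc r)) e (build G))
        (trans (arith (q * (Δ * c + h)) r Δ) (sym (maxEdges-+ q (suc (suc r)) r<c)))
        (subst (λ k → IsBlock Δ k (q * (Δ * c + h) + (r * Δ + (Δ + Δ))) (build G))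
          (cong (q * c +_) (trans (+-comm (r * 1) 2) (cong (2 +_) (*-identityʳ r))))
          (copiesOnto-isBlock q D _ D-block (copiesOnto-isBlock r (star Δ) G S B)))
        where
        arith : ∀ x r d → x + (r * d + (d + d)) ≡ x + suc (suc r) * d
        arith = solve-∀
      order≢ : suc Δ + suc Δ ≢ suc (suc Δ)
      order≢ p = contradiction (+-cancelˡ-≡ (suc Δ) (suc Δ) 1 (trans p (+-comm 1 (suc Δ)))) λ { refl → contradiction 2≤Δ λ () }

    -- With remainder 1 the freedom lies in one block together with the star, which `A` replaces;
    -- hence at least one block is required.
    one-star : ∀ q → 1 < c → 1 ≤ Δ → (A : Graph) → IsBlock Δ (c + 1) (Δ * c + h + Δ) A → n D + suc Δ ≢ n A →
      Alternatives (suc q * c + 1)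
    one-star q 1<c 1≤Δ A A-block order≢ = build (union D (star Δ)) , build A ,
      build-block (union-isBlock D (star Δ) D-block (star-isBlock 1≤Δ)) , build-block A-block , λ e →
        order≢ (+-cancelˡ-≡ (q * n D) _ _ (trans (sym (copiesOnto-order q D _)) (trans e (copiesOnto-order q D _))))
      where
      build : Graph → Graph
      build G = copiesOnto q D G
      build-block : ∀ {G} → IsBlock Δ (c + 1) (Δ * c + h + Δ) G → IsBlock Δ (suc q * c + 1) (maxEdges (suc q * c + 1)) (build G)
      build-block {G} B = subst (λ e → IsBlock Δ (suc q * c + 1) e (build G))
        (trans (arith q (Δ * c + h) Δ) (sym (maxEdges-+ (suc q) 1 1<c)))
        (subst (λ k → IsBlock Δ k (q * (Δ * c + h) + (Δ * c + h + Δ)) (build G)) (arith′ q c)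
          (copiesOnto-isBlock q D G D-block B))
        where
        arith : ∀ q x d → q * x + (x + d) ≡ suc q * x + 1 * d
        arith = solve-∀
        arith′ : ∀ q c → q * c + (c + 1) ≡ suc q * c + 1
        arith′ = solve-∀

    alternatives-from : ∀ q r → 1 ≤ r → r < c → q * c + r ≢ 1 → 2 ≤ Δ →
      (∃ λ A → IsBlock Δ (c + 1) (Δ * c + h + Δ) A × n D + suc Δ ≢ n A) → Alternatives (q * c + r)
    alternatives-from q       (suc (suc r)) _ r<c _   2≤Δ _ = many-stars q r r<c 2≤Δ
    -- Remainder 1 without any block is the exceptional case ν = 1.
    alternatives-from zero    1             _ r<c ν≢1 _   _ = contradiction refl ν≢1
    alternatives-from (suc q) 1             _ r<c _   2≤Δ (A , A-block , order≢) =
      one-star q r<c (≤-trans (s≤s z≤n) 2≤Δ) A A-block order≢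

even-components : ∀ {c} → 2 ≤ c → Σ Graph λ D → IsBlock (c + c) c ((c + c) * c + c) D ×
  ∃ λ A → IsBlock (c + c) (c + 1) ((c + c) * c + c + (c + c)) A × n D + suc (c + c) ≢ n A
even-components {suc (suc m)} (s≤s (s≤s _)) = complement (empty (suc (c + c))) , complete-isBlock {c} (s≤s z≤n) ,
  complement (cycles m) , coCycles-isBlock m , λ e → order≢ (trans e (cycles-order m))
  where
  c = suc (suc m)
  order≢ : suc (c + c) + suc (c + c) ≢ 7 + (m + m)
  order≢ e = contradiction (≤-reflexive (trans (sym (arith m)) e)) (m+1+n≰m (7 + (m + m)))
    where
    arith : ∀ m → suc (suc (suc m) + suc (suc m)) + suc (suc (suc m) + suc (suc m)) ≡ 7 + (m + m) + suc (2 + (m + m))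
    arith = solve-∀

odd-components : ∀ {h} → 1 ≤ h → Σ Graph λ D → IsBlock (h + suc h) (suc h) ((h + suc h) * suc h + h) D ×
  ∃ λ A → IsBlock (h + suc h) (suc h + 1) ((h + suc h) * suc h + h + (h + suc h)) A × n D + suc (h + suc h) ≢ n A
odd-components {h} 1≤h = nearComplete h , nearComplete-isBlock 1≤h , shared h , shared-isBlock 1≤h , order≢
  where
  order≢ : n (nearComplete h) + suc (h + suc h) ≢ n (shared h)
  order≢ e = contradiction (+-cancelˡ-≡ h _ _ (suc-injective
    (+-cancelˡ-≡ (n (nearComplete h)) _ _ (trans e (sym (+-suc _ (h + h))))))) 1+n≢n

components : ∀ {c h} → h ≤ c → c ≤ suc h → 2 ≤ c → Σ Graph λ D → IsBlock (h + c) c ((h + c) * c + h) D ×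
  ∃ λ A → IsBlock (h + c) (c + 1) ((h + c) * c + h + (h + c)) A × n D + suc (h + c) ≢ n A
components {c} {h} h≤c c≤1+h 2≤c with c Data.Nat.≟ h
... | yes refl = even-components 2≤c
... | no c≢h with ≤-antisym c≤1+h (≤∧≢⇒< h≤c (c≢h ∘ sym))
...   | refl = odd-components (≤-pred 2≤c)

divide : ∀ {c ν} → 1 ≤ c → ¬ c ∣ ν → ∃₂ λ q r → ν ≡ q * c + r × 1 ≤ r × r < c
divide {suc c} {ν} _ c∤ν = ν / suc c , ν % suc c , trans (m≡m%n+[m/n]*n ν (suc c)) (+-comm (ν % suc c) _) ,
  n≢0⇒n>0 (c∤ν ∘ m%n≡0⇒n∣m ν (suc c)) , m%n<n ν (suc c)

alternatives : ∀ {Δ c h} (Δ≡ : h + c ≡ Δ) (h≤c : h ≤ c) (c≤1+h : c ≤ suc h) (1≤c : 1 ≤ c) ν → ¬ c ∣ ν → ν ≢ 1 →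
  Existence.Alternatives Δ c h Δ≡ h≤c c≤1+h 1≤c ν
alternatives {c = c} {h} refl h≤c c≤1+h 1≤c ν c∤ν ν≢1 with divide 1≤c c∤ν
-- A nonzero remainder forces c ≥ 2, so Δ ≥ 3 and both kinds of components exist.
... | q , r , refl , 1≤r , r<c with components h≤c c≤1+h (≤-trans (s≤s 1≤r) r<c)
...   | D , D-block , A = Existence.alternatives-from (h + c) c h refl h≤c c≤1+h 1≤c D D-block q r 1≤r r<c ν≢1
        (≤-trans (≤-trans (s≤s 1≤r) r<c) (m≤n+m c h)) A

not-unique : ∀ Δ ν → 1 ≤ Δ → 1 ≤ ν → ¬ ⌈ Δ /2⌉ ∣ ν → ν ≢ 1 →
  ∃₂ λ G H → Extremal Δ ν G × Extremal Δ ν H × n G ≢ n H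
not-unique Δ ν 1≤Δ 1≤ν c∤ν ν≢1 with alternatives (⌊n/2⌋+⌈n/2⌉≡n Δ) (⌊n/2⌋≤⌈n/2⌉ Δ) (⌈n/2⌉≤1+⌊n/2⌋ Δ) (⌈n/2⌉-mono 1≤Δ) ν c∤ν ν≢1
... | G , H , B , C , order≢ = G , H , extremal B , extremal C , order≢
  where
  open Existence Δ ⌈ Δ /2⌉ ⌊ Δ /2⌋ (⌊n/2⌋+⌈n/2⌉≡n Δ) (⌊n/2⌋≤⌈n/2⌉ Δ) (⌈n/2⌉≤1+⌊n/2⌋ Δ) (⌈n/2⌉-mono 1≤Δ)
  extremal : ∀ {G} → IsBlock Δ ν (Δ * ν + fdiv ν ⌈ Δ /2⌉ * ⌊ Δ /2⌋) G → Extremal Δ ν G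
  extremal B with matchingNumber 1≤Δ 1≤ν B
  ... | edges , number = noIsolated B , degrees B , number , edges

theorem5 : (Δ ν : ℕ) → 1 ≤ Δ → 1 ≤ ν →
    ((∀ G H → Extremal Δ ν G → Extremal Δ ν H → Isomorphic G H)
    → (⌈ Δ /2⌉ ∣ ν ⊎ ν ≡ 1))
    × ((⌈ Δ /2⌉ ∣ ν ⊎ ν ≡ 1)
    → (∀ G H → Extremal Δ ν G → Extremal Δ ν H → Isomorphic G H))
theorem5 Δ ν 1≤Δ 1≤ν = necessary , sufficient
  where
  necessary : (∀ G H → Extremal Δ ν G → Extremal Δ ν H → Isomorphic G H) → ⌈ Δ /2⌉ ∣ ν ⊎ ν ≡ 1
  necessary unique with ⌈ Δ /2⌉ ∣? ν | ν Data.Nat.≟ 1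
  ... | yes c∣ν | _       = inj₁ c∣ν
  ... | no _    | yes ν≡1 = inj₂ ν≡1
  ... | no c∤ν  | no ν≢1 with not-unique Δ ν 1≤Δ 1≤ν c∤ν ν≢1
  ...   | G , H , X , Y , order≢ = contradiction (↔⇒≡ (proj₁ (unique G H X Y))) order≢
  sufficient : ⌈ Δ /2⌉ ∣ ν ⊎ ν ≡ 1 → ∀ G H → Extremal Δ ν G → Extremal Δ ν H → Isomorphic G H
  sufficient cond G H X Y with determined Δ ν 1≤Δ cond
  ... | s , realize = realizes⇒isomorphic (λ _ → refl) (λ _ → refl) (realize G X) (realize H Y)
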